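{- If $T\ne K_2$ is a tree with $\ell\ge 2$ leaves, then no rational in $[0,\ell]\setminus\mathbb{Z}$ is realizable for $T$.
   Context: Graphs are finite and simple; $v(H)$ denotes the number of vertices of $H$. A leaf of a tree is a vertex of degree $1$. A graph is $\mathcal{F}$-free, for a family of graphs $\mathcal{F}$, if it contains no (not necessarily induced) subgraph isomorphic to a member of $\mathcal{F}$. $\mathrm{ex}(n,H,\mathcal{F})$ is the maximum number of copies of $H$ (subgraphs isomorphic to $H$) that an $n$-vertex $\mathcal{F}$-free graph can have, with the convention that it is $0$ if there is no $\mathcal{F}$-free graph on $n$ vertices. A rational number $r\in[0,v(H)]$ is realizable for $H$ if there exists a finite family of graphs $\mathcal{F}$ such that $\mathrm{ex}(n,H,\mathcal{F})=\Theta(n^r)$ as $n\to\infty$. -}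

module Defs where

open import Data.Bool.Base using (true; false)
open import Data.Fin.Base using (Fin; zero; suc; inject₁; fromℕ)
import Data.Fin.Properties as Fin
open import Data.Fin.Subset using (Subset; _∈_; _∉_; ∣_∣; ⊤)
open import Data.Fin.Subset.Properties using (_∈?_; anySubset?)
import Data.Integer.Base as ℤ
open import Data.List.Base using (List; []; _∷_; length; filter; map; mapMaybe; allFin; cartesianProductWith)
open import Data.List.Extrema.Nat using (max)
open import Data.List.Relation.Unary.All using (All; all?)
import Data.Maybe.Base as Maybe
open import Data.Nat.Base using (ℕ; zero; suc; _+_; _*_; _^_; _≤_)
import Data.Nat.Properties as ℕ
open import Data.Product using (∃; ∃-syntax; _×_; _,_)
open import Data.Rational.Base using (ℚ; 0ℚ; ↥_; ↧ₙ_; _/_)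
import Data.Rational.Base as ℚ
open import Data.Vec.Base using (Vec; []; _∷_; lookup)
open import Function.Base using (_∘_)
open import Function.Bundles using (_⇔_; mk⇔; Equivalence)
open import Function.Definitions using (Injective)
open import Relation.Binary.Construct.Closure.ReflexiveTransitive using (Star)
open import Relation.Binary.PropositionalEquality using (_≡_)
open import Relation.Nullary using (Dec; ¬_)
open import Relation.Nullary.Decidable using (map′; dec⇒maybe; from-yes; ¬?; _×-dec_; _→-dec_)
open import Relation.Unary using (Decidable)

private
  variable
    A : Set
    m n : ℕ

-- Adjacency is stored as first-order data (the neighbourhood of each vertex),
-- so that graphs and subgraphs can be enumerated without repetition and
-- propositional equality of such data is equality of graphs.

Neighbourhoods : ℕ → Set
Neighbourhoods n = Vec (Subset n) n

Simple : Neighbourhoods n → Set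
Simple N = (∀ u w → w ∈ lookup N u → u ∈ lookup N w) × (∀ u → u ∉ lookup N u)

simple? : Decidable (Simple {n})
simple? N =
  (Fin.all? λ u → Fin.all? λ w → (w ∈? lookup N u) →-dec (u ∈? lookup N w))
    ×-dec (Fin.all? λ u → ¬? (u ∈? lookup N u))

record Graph (n : ℕ) : Set where
  constructor graph
  field
    nbr    : Neighbourhoods n
    simple : Simple nbr

  Adj : Fin n → Fin n → Set
  Adj u w = w ∈ lookup nbr u

  degree : Fin n → ℕ
  degree u = ∣ lookup nbr u ∣

open Graph public

K₂ : Graph 2
K₂ = graph N (from-yes (simple? N))
  where
  N : Neighbourhoods 2
  N = (false ∷ true ∷ []) ∷ (true ∷ false ∷ []) ∷ []

-- A vertex set together with an edge set, both inside Fin n.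

record Part (n : ℕ) : Set where
  constructor part
  field
    vertices : Subset n
    edges    : Neighbourhoods n

open Part public

whole : Graph n → Part n
whole G = part ⊤ (nbr G)

record _IsSubgraphOf_ (S : Part n) (G : Graph n) : Set where
  constructor isSubgraph
  field
    symmetric : ∀ u w → w ∈ lookup (edges S) u → u ∈ lookup (edges S) w
    incident  : ∀ u w → w ∈ lookup (edges S) u → u ∈ vertices S × w ∈ vertices S
    included  : ∀ u w → w ∈ lookup (edges S) u → Adj G u w

-- The map sending i to lookup f i is a bijection from the vertices of H onto
-- those of S, preserving and reflecting adjacency.

record IsIso (H : Graph m) (S : Part n) (f : Vec (Fin n) m) : Set where
  constructor isIso
  field
    injective : Injective _≡_ _≡_ (lookup f)
    image     : ∀ x → x ∈ vertices S ⇔ (∃[ i ] lookup f i ≡ x)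
    adjacency : ∀ i j → Adj H i j ⇔ lookup f j ∈ lookup (edges S) (lookup f i)

infix 4 _≅_ _IsSubgraphOf_

_≅_ : Graph m → Part n → Set
H ≅ S = ∃ (IsIso H S)

IsCopy : Graph m → Graph n → Part n → Set
IsCopy H G S = S IsSubgraphOf G × H ≅ S

module _ (G : Graph n) where

  Connected : Set
  Connected = ∀ u w → Star (Adj G) u w

  record Cycle : Set where
    field
      extra   : ℕ
      visit   : Fin (3 + extra) → Fin n
      simple  : Injective _≡_ _≡_ visit
      step    : ∀ i → Adj G (visit (inject₁ i)) (visit (suc i))
      closing : Adj G (visit (fromℕ (2 + extra))) (visit zero)

  record IsTree : Set where
    field
      nonempty  : 1 ≤ n
      connected : Connected
      acyclic   : ¬ Cycle

  leaves : ℕ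
  leaves = length (filter (λ u → degree G u ℕ.≟ 1) (allFin n))

Family : Set
Family = List (∃ Graph)

Free : Family → Graph n → Set
Free 𝓕 G = All (λ (_ , F) → ¬ (∃[ S ] IsCopy F G S)) 𝓕

private
  iff? : {A B : Set} → Dec A → Dec B → Dec (A ⇔ B)
  iff? a? b? = map′ (λ (f , g) → mk⇔ f g) (λ e → Equivalence.to e , Equivalence.from e)
                    ((a? →-dec b?) ×-dec (b? →-dec a?))

  anyVec? : (∀ {P : A → Set} → Decidable P → Dec (∃ P)) →
            ∀ {k} {P : Vec A k → Set} → Decidable P → Dec (∃ P)
  anyVec? any? {zero}  P? = map′ ([] ,_) (λ { ([] , p) → p }) (P? [])
  anyVec? any? {suc k} P? = map′
    (λ (x , xs , p) → x ∷ xs , p) (λ { (x ∷ xs , p) → x , xs , p })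
    (any? λ x → anyVec? any? λ xs → P? (x ∷ xs))

isSubgraph? : (S : Part n) (G : Graph n) → Dec (S IsSubgraphOf G)
isSubgraph? S G = map′
  (λ (s , i , c) → isSubgraph s i c) (λ (isSubgraph s i c) → s , i , c)
  ( edge? (λ u w → u ∈? lookup (edges S) w)
    ×-dec edge? (λ u w → (u ∈? vertices S) ×-dec (w ∈? vertices S))
    ×-dec edge? (λ u w → w ∈? lookup (nbr G) u))
  where
  edge? : {P : _ → _ → Set} → (∀ u w → Dec (P u w)) →
          Dec (∀ u w → w ∈ lookup (edges S) u → P u w)
  edge? P? = Fin.all? λ u → Fin.all? λ w → (w ∈? lookup (edges S) u) →-dec P? u w

isIso? : (H : Graph m) (S : Part n) → Decidable (IsIso H S)
isIso? H S f = map′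
  (λ (j , i , a) → isIso (j _ _) i a) (λ (isIso j i a) → (λ _ _ → j) , i , a)
  ( (Fin.all? λ i → Fin.all? λ j → (lookup f i Fin.≟ lookup f j) →-dec (i Fin.≟ j))
    ×-dec (Fin.all? λ x → iff? (x ∈? vertices S) (Fin.any? λ i → lookup f i Fin.≟ x))
    ×-dec (Fin.all? λ i → Fin.all? λ j →
      iff? (j ∈? lookup (nbr H) i) (lookup f j ∈? lookup (edges S) (lookup f i))))

isCopy? : (H : Graph m) (G : Graph n) → Decidable (IsCopy H G)
isCopy? H G S = isSubgraph? S G ×-dec anyVec? Fin.any? (isIso? H S)

free? : (𝓕 : Family) → Decidable (Free {n} 𝓕)
free? 𝓕 G = all? (λ (_ , F) → ¬? (map′
  (λ (V , E , c) → part V E , c) (λ (part V E , c) → V , E , c)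
  (anySubset? λ V → anyVec? anySubset? λ E → isCopy? F G (part V E)))) 𝓕

-- If xs lists every element of A exactly once, vectors xs k does so for Vec A k;
-- hence parts n and graphs n list every vertex/edge set, respectively every
-- graph on Fin n, exactly once.

vectors : List A → ∀ k → List (Vec A k)
vectors xs zero    = [] ∷ []
vectors xs (suc k) = cartesianProductWith _∷_ xs (vectors xs k)

subsets : ∀ n → List (Subset n)
subsets = vectors (false ∷ true ∷ [])

parts : ∀ n → List (Part n)
parts n = cartesianProductWith part (subsets n) (vectors (subsets n) n)

graphs : ∀ n → List (Graph n)
graphs n = mapMaybe (λ N → Maybe.map (graph N) (dec⇒maybe (simple? N)))
                    (vectors (subsets n) n)

copies : Graph m → Graph n → ℕ
copies {n = n} H G = length (filter (isCopy? H G) (parts n))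

-- max takes the value 0 on the empty list, as the convention for the absence of
-- 𝓕-free graphs demands.

ex : ℕ → Graph m → Family → ℕ
ex n H 𝓕 = max 0 (map (copies H) (filter (free? 𝓕) (graphs n)))

-- For r = p/q ≥ 0 in lowest terms, f(n) = Θ(n^r) says that n^(p/q) ≤ c f(n) and
-- f(n) ≤ C n^(p/q) for all large n.  Both sides are raised to the power q to
-- avoid real roots; natural constants suffice, as the real ones can be rounded
-- up.  The lower bound forces c to be positive.

IsΘ-n^ : ℚ → (ℕ → ℕ) → Set
IsΘ-n^ r f = ∃[ c ] ∃[ C ] ∃[ N ] ∀ n → N ≤ n →
  n ^ p ≤ (c * f n) ^ q × f n ^ q ≤ C ^ q * n ^ p
  where
  p q : ℕ
  p = ℤ.∣ ↥ r ∣
  q = ↧ₙ r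

fromℕ/1 : ℕ → ℚ
fromℕ/1 k = ℤ.+ k / 1

Integral : ℚ → Set
Integral r = ∃[ z ] r ≡ z / 1

Realizable : Graph m → ℚ → Set
Realizable {m} H r =
  0ℚ ℚ.≤ r × r ℚ.≤ fromℕ/1 m × (∃[ 𝓕 ] IsΘ-n^ r (λ n → ex n H 𝓕))

{-# OPTIONS --safe #-}

-- Let k < ℓ.  If an 𝓕-free graph G on n vertices has more than B n^k embeddings of T,
-- for a large constant B, then G contains a blow-up of T: many copies of T which agree
-- on a kernel K and are disjoint elsewhere, where T - K has at least k + 1 components.
-- Each component can be chosen from any petal independently, and a member of 𝓕 sees
-- only boundedly many petals, so blow-ups with arbitrarily many petals are 𝓕-free and
-- contain of order n^(k+1) copies of T.  Hence the exponent cannot lie strictly between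
-- k and k + 1.
--
-- To find the blow-up: if G has a subgraph of large minimum degree, T embeds there and
-- all its ℓ leaves can be multiplied.  Otherwise the vertices of G are ranked so that
-- each has few neighbours of rank at least its own.  For an embedding φ call a connected
-- set C of vertices of T free if C alone can be moved to many disjoint places, every edge
-- of T keeping its orientation by rank; disjoint free sets are then nonadjacent.  By the
-- Helly property of subtrees either some φ has k + 1 disjoint free sets, which yields a
-- blow-up, or for every φ some k vertices U of T meet all free sets.  In the latter case
-- fix the orientation, U, and the values of φ on U, at a cost of O(n^k).  If many φ
-- remained, they would contain a sunflower, and a component of its moving part would be
-- a free set missing U.
module Submission where

open import Defs

import Algebra.Properties.CommutativeSemigroup as CommutativeSemigroup
open import Data.Bool.Base using (Bool; true; false; if_then_else_)
open import Data.Fin.Base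
  using (Fin; zero; suc; combine; remQuot; inject≤; inject₁; fromℕ; fromℕ<; opposite; splitAt; _↑ˡ_; _↑ʳ_)
import Data.Fin.Properties as Fin
open import Data.Fin.Subset using (Subset; _∈_; _∉_; ∣_∣; Nonempty; ⁅_⁆) renaming (⊤ to ⊤ˢ)
open import Data.Fin.Subset.Properties
  using (_∈?_; nonempty?; anySubset?; x∈⁅x⁆; x∈⁅y⁆⇒x≡y; ∈⊤; ∣p∣≤n; ∣⊥∣≡0; ∣⊤∣≡n; Empty-unique; ⊆-antisym; p⊂q⇒∣p∣<∣q∣)
import Data.Integer.Base as ℤ
import Data.Integer.Properties as ℤ
open import Data.List.Base as List using (List; []; _∷_; _++_; length; filter; allFin)
import Data.List.Extrema.Nat as Extrema
import Data.List.Membership.DecPropositional as DecMem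
open import Data.List.Membership.Propositional using (find; lose) renaming (_∈_ to _∈ˡ_; _∉_ to _∉ˡ_)
import Data.List.Membership.Propositional.Properties as ListMem
import Data.List.Membership.Setoid.Properties as SetoidMem
import Data.List.Properties as List
open import Data.List.Relation.Binary.Sublist.Propositional using (_⊆_; []; _∷_; _∷ʳ_; ⊆-refl; ⊆-trans)
open import Data.List.Relation.Binary.Sublist.Propositional.Properties using (All-resp-⊆)
open import Data.List.Relation.Unary.All as All using (All; []; _∷_)
import Data.List.Relation.Unary.All.Properties as All
open import Data.List.Relation.Unary.AllPairs using (AllPairs; []; _∷_)
open import Data.List.Relation.Unary.Any as Any using (Any; here; there)
import Data.List.Relation.Unary.Any.Properties as Any
open import Data.List.Relation.Unary.Unique.Propositional using (Unique)
import Data.List.Relation.Unary.Unique.Propositional.Properties as Unique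
open import Data.Maybe.Base as Maybe using (Maybe; just; nothing)
import Data.Maybe.Relation.Unary.Any as MaybeAny
open import Data.Nat.Base using (ℕ; zero; suc; _+_; _*_; _^_; _∸_; _≤_; _<_; z≤n; s≤s; NonZero)
open import Data.Nat.Coprimality using (recompute) renaming (sym to coprime-sym; 1-coprimeTo to coprime-1)
open import Data.Nat.Divisibility using (divides; ∣-refl)
open import Data.Nat.DivMod using (_/_; _%_; m≡m%n+[m/n]*n; m%n<n)
import Data.Nat.Properties as ℕ
open import Data.Product using (∃; ∃-syntax; _×_; _,_; proj₁; proj₂)
open import Data.Rational.Base using (ℚ; mkℚ; 0ℚ; ↥_; ↧ₙ_) renaming (_≤_ to _≤ℚ_)
import Data.Rational.Properties as ℚ
open import Data.Sum.Base using (_⊎_; inj₁; inj₂)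
open import Data.Unit.Base using (⊤; tt)
open import Data.Vec.Base as Vec using (Vec; []; _∷_; lookup)
open import Data.Vec.Functional using (updateAt)
open import Data.Vec.Functional.Properties using (updateAt-updates; updateAt-minimal)
import Data.Vec.Properties as Vec
open import Function.Base using (_∘_; id; const)
open import Function.Bundles using (_⇔_; mk⇔; Equivalence)
open import Function.Definitions using (Injective)
open import Relation.Binary.Construct.Closure.ReflexiveTransitive using (Star; ε; _◅_)
open import Relation.Binary.Definitions using (DecidableEquality)
open import Relation.Binary.PropositionalEquality
  using (_≡_; _≢_; refl; sym; trans; cong; cong₂; subst; subst₂; setoid; module ≡-Reasoning)
open import Relation.Nullary using (Dec; yes; no; ¬_; does; contradiction)
open import Relation.Nullary.Decidable
  using (¬?; _×-dec_; _⊎-dec_; _→-dec_; map′; dec-true; dec-false; dec⇒maybe; decidable-stable)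
open import Relation.Unary using (Decidable)

private
  variable
    A B : Set
    a b k m n s t D Q : ℕ

-- Lists without repetition

AllPairs-resp-⊆ : {R : A → A → Set} {xs ys : List A} → ys ⊆ xs → AllPairs R xs → AllPairs R ys
AllPairs-resp-⊆ []         []       = []
AllPairs-resp-⊆ (_ ∷ʳ s)   (_ ∷ rs) = AllPairs-resp-⊆ s rs
AllPairs-resp-⊆ (refl ∷ s) (r ∷ rs) = All-resp-⊆ s r ∷ AllPairs-resp-⊆ s rs

lookup-injective : {xs : List A} → Unique xs → ∀ i j → List.lookup xs i ≡ List.lookup xs j → i ≡ j
lookup-injective (_ ∷ _)  zero    zero    _  = refl
lookup-injective (x ∷ _)  zero    (suc j) eq = contradiction eq (All.lookup x (ListMem.∈-lookup j))
lookup-injective (x ∷ _)  (suc i) zero    eq = contradiction (sym eq) (All.lookup x (ListMem.∈-lookup i))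
lookup-injective (_ ∷ xs) (suc i) (suc j) eq = cong suc (lookup-injective xs i j eq)

unique-length-≤ : {xs ys : List A} → Unique xs → (∀ {x} → x ∈ˡ xs → x ∈ˡ ys) → length xs ≤ length ys
unique-length-≤ {xs = xs} {ys} u xs⊆ys = Fin.injective⇒≤ {f = f} f-injective
  where
  f : Fin (length xs) → Fin (length ys)
  f i = Any.index (xs⊆ys (ListMem.∈-lookup i))

  f-injective : Injective _≡_ _≡_ f
  f-injective {i} {j} eq = lookup-injective u i j
    (SetoidMem.index-injective (setoid _) (xs⊆ys (ListMem.∈-lookup i)) (xs⊆ys (ListMem.∈-lookup j)) eq)

module _ (_≟_ : DecidableEquality A) where
  open import Data.List.Membership.DecPropositional _≟_ using () renaming (_∈?_ to _∈ˡ?_)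

  unique-avoid : (xs ys : List A) → Unique xs → length xs ≤ length (filter (λ x → ¬? (x ∈ˡ? ys)) xs) + length ys
  unique-avoid xs ys u = subst (length xs ≤_) (List.length-++ (filter ∉ys? xs)) (unique-length-≤ u split)
    where
    ∉ys? : Decidable (λ x → ¬ (x ∈ˡ ys))
    ∉ys? x = ¬? (x ∈ˡ? ys)
    split : ∀ {x} → x ∈ˡ xs → x ∈ˡ filter ∉ys? xs ++ ys
    split {x} x∈ with x ∈ˡ? ys
    ... | yes x∈ys = ListMem.∈-++⁺ʳ (filter ∉ys? xs) x∈ys
    ... | no  x∉ys = ListMem.∈-++⁺ˡ (ListMem.∈-filter⁺ ∉ys? x∈ x∉ys)

  fresh : (xs ys : List A) → Unique xs → length ys < length xs → ∃[ x ] x ∈ˡ xs × x ∉ˡ ys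
  fresh xs ys u <xs with filter (λ x → ¬? (x ∈ˡ? ys)) xs in eq | unique-avoid xs ys u
  ... | []    | ≤ys = contradiction ≤ys (ℕ.<⇒≱ <xs)
  ... | z ∷ _ | _ = z , ListMem.∈-filter⁻ _ (subst (z ∈ˡ_) (sym eq) (here refl))

-- Pigeonhole principles

-- Colours come from a relation, not a function, because one element may admit several, as when a
-- function hits a petal in several places. The answer is a sublist, so that uniqueness and `All`
-- facts pass to it.
Pigeonhole : Set → ℕ → Set₁
Pigeonhole A b = ∀ {X : Set} {R : A → X → Set} (xs : List X) (c : ℕ) →
  All (λ x → ∃[ a ] R a x) xs → b * c < length xs →
  ∃[ a ] ∃[ ys ] ys ⊆ xs × c < length ys × All (R a) ys

private
  split⊎ : {X : Set} {P Q : X → Set} (xs : List X) → All (λ x → P x ⊎ Q x) xs →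
    ∃[ ys ] ∃[ zs ] (ys ⊆ xs × All P ys) × (zs ⊆ xs × All Q zs) × length xs ≡ length ys + length zs
  split⊎ []       []       = [] , [] , ([] , []) , ([] , []) , refl
  split⊎ (x ∷ xs) (r ∷ rs) with split⊎ xs rs
  ... | ys , zs , (s , p) , (s′ , q) , eq with r
  ...   | inj₁ px = x ∷ ys , zs , (refl ∷ s , px ∷ p) , (x ∷ʳ s′ , q) , cong suc eq
  ...   | inj₂ qx = ys , x ∷ zs , (x ∷ʳ s , p) , (refl ∷ s′ , qx ∷ q) ,
                    trans (cong suc eq) (sym (ℕ.+-suc (length ys) (length zs)))

pigeonhole-Fin : ∀ b → Pigeonhole (Fin b) b
pigeonhole-Fin zero    (_ ∷ _) c ((() , _) ∷ _) _
pigeonhole-Fin (suc b) {R = R} xs c w large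
  with split⊎ {P = R zero} {Q = λ x → ∃[ i ] R (suc i) x} xs
         (All.map (λ { (zero , r) → inj₁ r ; (suc i , r) → inj₂ (i , r) }) w)
... | ys , zs , (s , p) , (s′ , q) , eq with suc c ℕ.≤? length ys
...   | yes c<ys = zero , ys , s , c<ys , p
...   | no  c≮ys
  with pigeonhole-Fin b zs c q (ℕ.+-cancelˡ-< c _ _ (ℕ.<-≤-trans large
         (subst (_≤ c + length zs) (sym eq) (ℕ.+-monoˡ-≤ (length zs) (ℕ.≮⇒≥ c≮ys)))))
...     | i , us , s″ , c<us , r = suc i , us , ⊆-trans s″ s′ , c<us , r

pigeonhole-Bool : Pigeonhole Bool 2
pigeonhole-Bool {R = R} xs c w large
  with pigeonhole-Fin 2 {R = λ i → R (bool i)} xs c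
         (All.map (λ { (false , r) → zero , r ; (true , r) → suc zero , r }) w) large
  where
  bool : Fin 2 → Bool
  bool zero    = false
  bool (suc _) = true
... | i , rest = _ , rest

-- The coordinates are fixed one at a time: the relation for the head merely asserts that some tail
-- exists.
pigeonhole-Vec : Pigeonhole A b → ∀ k → Pigeonhole (Vec A k) (b ^ k)
pigeonhole-Vec php zero xs c w large =
  [] , xs , ⊆-refl , subst (_< length xs) (ℕ.+-identityʳ c) large , All.map (λ { ([] , r) → r }) w
pigeonhole-Vec {b = b} php (suc k) {R = R} xs c w large
  with php {R = λ a x → ∃[ v ] R (a ∷ v) x} xs (b ^ k * c) (All.map (λ { (a ∷ v , r) → a , v , r }) w)
         (subst (_< length xs) (ℕ.*-assoc b (b ^ k) c) large)
... | a , ys , s , large′ , w′ with pigeonhole-Vec php k ys c w′ large′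
...   | v , zs , s′ , c<zs , r = a ∷ v , zs , ⊆-trans s′ s , c<zs , r

-- Subsets of Fin n cut out by decidable predicates

module _ {P : Fin n → Set} (P? : Decidable P) where
  ⟦_⟧ : Subset n
  ⟦_⟧ = Vec.tabulate (does ∘ P?)

  ∈⟦⟧⁺ : ∀ {x} → P x → x ∈ ⟦_⟧
  ∈⟦⟧⁺ {x} p = Vec.lookup⇒[]= x _ (trans (Vec.lookup∘tabulate _ x) (dec-true (P? x) p))

  ∈⟦⟧⁻ : ∀ {x} → x ∈ ⟦_⟧ → P x
  ∈⟦⟧⁻ {x} x∈ with P? x | trans (sym (Vec.lookup∘tabulate (does ∘ P?) x)) (Vec.[]=⇒lookup x∈)
  ... | yes p | _  = p
  ... | no  _ | ()

∖? : (p : Subset n) (x : Fin n) → Decidable (λ y → y ∈ p × y ≢ x)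
∖? p x y = (y ∈? p) ×-dec ¬? (y Fin.≟ x)

_∖_ : Subset n → Fin n → Subset n
p ∖ x = ⟦ ∖? p x ⟧

∈∖⁺ : ∀ {p : Subset n} {x y} → y ∈ p → y ≢ x → y ∈ p ∖ x
∈∖⁺ y∈p y≢x = ∈⟦⟧⁺ (∖? _ _) (y∈p , y≢x)

∈∖⁻ : ∀ {p : Subset n} {x y} → y ∈ p ∖ x → y ∈ p × y ≢ x
∈∖⁻ = ∈⟦⟧⁻ (∖? _ _)

∣∖∣< : ∀ {p : Subset n} {x} → x ∈ p → ∣ p ∖ x ∣ < ∣ p ∣
∣∖∣< {x = x} x∈p = p⊂q⇒∣p∣<∣q∣ (proj₁ ∘ ∈∖⁻ , x , x∈p , λ x∈ → proj₂ (∈∖⁻ x∈) refl)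

-- Sunflowers of functions Fin t → Fin n

record Sunflower (D : ℕ) (xs : List (Vec (Fin n) t)) (R : Subset t) : Set where
  field
    moving   : Subset t
    moving⊆  : ∀ {v} → v ∈ moving → v ∈ R
    nonempty : Nonempty moving
    petal    : Fin D → Vec (Fin n) t
    petal∈   : ∀ i → petal i ∈ˡ xs
    kernel   : ∀ i j {v} → v ∉ moving → lookup (petal i) v ≡ lookup (petal j) v
    disjoint : ∀ {i j} → i ≢ j → ∀ {v w} → v ∈ moving → w ∈ moving →
               lookup (petal i) v ≢ lookup (petal j) w

-- Here `j` bounds the number of positions that may still vary. The factors `t`, `D`, `t` pay for
-- the three pigeonholes in `absorb`: a position, a petal, and a position in that petal. The `suc`
-- keeps the bound positive, as the case where no position varies demands.
sunflowerBound : ℕ → ℕ → ℕ → ℕ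
sunflowerBound t D zero    = 1
sunflowerBound t D (suc j) = suc (t * (D * (t * sunflowerBound t D j)))

sunflowerBound-positive : ∀ t D j → 1 ≤ sunflowerBound t D j
sunflowerBound-positive t D zero    = ℕ.≤-refl
sunflowerBound-positive t D (suc j) = s≤s z≤n

all-equal⇒short : {xs : List A} → Unique xs → (∀ {x y} → x ∈ˡ xs → y ∈ˡ xs → x ≡ y) → length xs ≤ 1
all-equal⇒short []                        _  = z≤n
all-equal⇒short (_ ∷ [])                  _  = s≤s z≤n
all-equal⇒short ((x≢y ∷ _) ∷ (_ ∷ _)) eq = contradiction (eq (here refl) (there (here refl))) x≢y

satisfied : {P : A → Set} {xs : List A} {c : ℕ} → c < length xs → All P xs → ∃ P
satisfied _ (p ∷ _) = _ , p

lookup-ext : {f g : Vec A n} → (∀ i → lookup f i ≡ lookup g i) → f ≡ g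
lookup-ext {f = f} {g} eq =
  trans (sym (Vec.tabulate∘lookup f)) (trans (Vec.tabulate-cong eq) (Vec.tabulate∘lookup g))

-- Either the petals can be chosen one by one, or some value taken by a petal is
-- taken by many functions in one position, which then joins the kernel.
sunflower : ∀ D j (R : Subset t) → ∣ R ∣ ≤ j → (xs : List (Vec (Fin n) t)) → Unique xs →
  (∀ {f g v} → f ∈ˡ xs → g ∈ˡ xs → v ∉ R → lookup f v ≡ lookup g v) →
  sunflowerBound t D j < length xs → Sunflower D xs R
sunflower {t = t} {n = n} D j R ∣R∣≤j xs u agree large with nonempty? R
... | no empty = contradiction
        (all-equal⇒short u λ f∈ g∈ → lookup-ext λ v → agree f∈ g∈ (λ v∈ → empty (v , v∈)))
        (ℕ.<⇒≱ (ℕ.≤-<-trans (sunflowerBound-positive t D j) large))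
sunflower D zero R ∣R∣≤j xs u agree large | yes (_ , x∈R) =
  contradiction (ℕ.<-≤-trans (∣∖∣< x∈R) ∣R∣≤j) λ ()
sunflower {t = t} {n = n} D (suc j) R ∣R∣≤j xs u agree large | yes nonempty with grow D ℕ.≤-refl
  where
  Disjoint : Vec (Fin n) t → Vec (Fin n) t → Set
  Disjoint f g = ∀ v w → v ∈ R → w ∈ R → lookup f v ≢ lookup g w

  Partial : ℕ → Set
  Partial d = ∃[ ψ ] (∀ (i : Fin d) → ψ i ∈ˡ xs) × (∀ {i k} → i ≢ k → Disjoint (ψ i) (ψ k))

  Hits : {d : ℕ} → (Fin d → Vec (Fin n) t) → Vec (Fin n) t → Fin t → Fin d → Fin t → Set
  Hits ψ f v i w = v ∈ R × lookup f v ≡ lookup (ψ i) w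

  hits? : ∀ {d} (ψ : Fin d → Vec (Fin n) t) f → Dec (∃[ v ] ∃[ i ] ∃[ w ] w ∈ R × Hits ψ f v i w)
  hits? ψ f = Fin.any? λ v → Fin.any? λ i → Fin.any? λ w →
    (w ∈? R) ×-dec ((v ∈? R) ×-dec (lookup f v Fin.≟ lookup (ψ i) w))

  bound : ℕ
  bound = sunflowerBound t D j

  absorb : ∀ {d} (ψ : Fin d → Vec (Fin n) t) → d < D →
    All (λ f → ∃[ v ] ∃[ i ] ∃[ w ] Hits ψ f v i w) xs → Sunflower D xs R
  absorb {d} ψ d<D covered
    with v , ys₁ , sub₁ , large₁ , hit₁ ← pigeonhole-Fin t xs (d * (t * bound)) covered
           (ℕ.≤-<-trans (ℕ.*-monoʳ-≤ t (ℕ.*-monoˡ-≤ (t * bound) (ℕ.<⇒≤ d<D))) (ℕ.<-trans ℕ.≤-refl large))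
    with i , ys₂ , sub₂ , large₂ , hit₂ ← pigeonhole-Fin d ys₁ (t * bound) hit₁ large₁
    with w , ys , sub₃ , large₃ , hit ← pigeonhole-Fin t ys₂ bound hit₂ large₂ =
      widen (sunflower D j (R ∖ v) (ℕ.≤-pred (ℕ.<-≤-trans (∣∖∣< v∈R) ∣R∣≤j)) ys
        (AllPairs-resp-⊆ sub u) agree′ large₃)
    where
    sub : ys ⊆ xs
    sub = ⊆-trans sub₃ (⊆-trans sub₂ sub₁)
    ∈xs : ∀ {f} → f ∈ˡ ys → f ∈ˡ xs
    ∈xs = All.lookup (All-resp-⊆ sub (All.tabulate id))
    v∈R : v ∈ R
    v∈R = proj₁ (proj₂ (satisfied large₃ hit))
    agree′ : ∀ {f g y} → f ∈ˡ ys → g ∈ˡ ys → y ∉ R ∖ v → lookup f y ≡ lookup g y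
    agree′ {y = y} f∈ g∈ y∉ with y Fin.≟ v
    ... | yes refl = trans (proj₂ (All.lookup hit f∈)) (sym (proj₂ (All.lookup hit g∈)))
    ... | no  y≢v  = agree (∈xs f∈) (∈xs g∈) (λ y∈R → y∉ (∈∖⁺ y∈R y≢v))
    widen : Sunflower D ys (R ∖ v) → Sunflower D xs R
    widen S = record
      { Sunflower S ; moving⊆ = proj₁ ∘ ∈∖⁻ ∘ Sunflower.moving⊆ S ; petal∈ = ∈xs ∘ Sunflower.petal∈ S }

  grow : ∀ d → d ≤ D → Partial d ⊎ Sunflower D xs R
  grow zero    _   = inj₁ ((λ ()) , (λ ()) , λ { {()} })
  grow (suc d) d<D with grow d (ℕ.<⇒≤ d<D)
  ... | inj₂ found = inj₂ found
  ... | inj₁ (ψ , ψ∈ , ψ#) with Any.any? (λ f → ¬? (hits? ψ f)) xs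
  ...   | yes new = inj₁ (ψ′ , ψ′∈ , λ {i} {k} → ψ′# i k)
    where
    f : Vec (Fin n) t
    f = proj₁ (find new)
    ψ′ : Fin (suc d) → Vec (Fin n) t
    ψ′ zero    = f
    ψ′ (suc i) = ψ i
    ψ′∈ : ∀ i → ψ′ i ∈ˡ xs
    ψ′∈ zero    = proj₁ (proj₂ (find new))
    ψ′∈ (suc i) = ψ∈ i
    f# : ∀ i → Disjoint f (ψ i)
    f# i v w v∈ w∈ eq = proj₂ (proj₂ (find new)) (v , i , w , w∈ , v∈ , eq)
    ψ′# : ∀ i k → i ≢ k → Disjoint (ψ′ i) (ψ′ k)
    ψ′# zero    zero    i≢k = contradiction refl i≢k
    ψ′# zero    (suc k) _   = f# k
    ψ′# (suc i) zero    _ v w v∈ w∈ eq = f# i w v w∈ v∈ (sym eq)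
    ψ′# (suc i) (suc k) i≢k = ψ# (i≢k ∘ cong suc)
  ...   | no none = inj₂ (absorb ψ d<D (All.map
            (λ {f} hit → let v , i , w , _ , h = decidable-stable (hits? ψ f) hit in v , i , w , h)
            (All.¬Any⇒All¬ xs none)))
... | inj₂ found = found
... | inj₁ (ψ , ψ∈ , ψ#) = record
  { moving = R ; moving⊆ = id ; nonempty = nonempty ; petal = ψ ; petal∈ = ψ∈
  ; kernel = λ i j → agree (ψ∈ i) (ψ∈ j) ; disjoint = λ i≢j → ψ# i≢j _ _ }

-- Embeddings, and trees grown leaf by leaf

record IsEmbedding (H : Graph a) (G : Graph b) (f : Fin a → Fin b) : Set where
  constructor isEmbedding
  field
    injective : ∀ {u w} → f u ≡ f w → u ≡ w
    preserves : ∀ {u w} → Adj H u w → Adj G (f u) (f w)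

adj-sym : (G : Graph n) → ∀ {u w} → Adj G u w → Adj G w u
adj-sym G = proj₁ (simple G) _ _

adj-irrefl : (G : Graph n) → ∀ {u w} → Adj G u w → u ≢ w
adj-irrefl G adj refl = proj₂ (simple G) _ adj

opposite-inject₁ : (i : Fin n) → opposite (inject₁ i) ≡ suc (opposite i)
opposite-inject₁ zero    = refl
opposite-inject₁ (suc i) = cong inject₁ (opposite-inject₁ i)

module _ (T : Graph t) where
  open DecMem (Fin._≟_ {t}) using () renaming (_∈?_ to _∈ˡ?_)

  -- A subtree with a leaf ordering, newest vertex first: each new vertex has exactly one neighbour
  -- among the older ones. The inductions over trees run along this order.
  data Grown : List (Fin t) → Set where
    root : ∀ r → Grown (r ∷ [])
    grow : ∀ {xs v x} → Grown xs → v ∉ˡ xs → x ∈ˡ xs → Adj T x v →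
           (∀ {y} → y ∈ˡ xs → Adj T y v → y ≡ x) → Grown (v ∷ xs)

  record Path (xs : List (Fin t)) (u w : Fin t) : Set where
    field
      len    : ℕ
      at     : Fin (suc len) → Fin t
      at-inj : Injective _≡_ _≡_ at
      start  : at zero ≡ u
      end    : at (fromℕ len) ≡ w
      step   : ∀ i → Adj T (at (inject₁ i)) (at (suc i))
      inside : ∀ i → at i ∈ˡ xs

  reverse : ∀ {xs u w} → Path xs u w → Path xs w u
  reverse p = record
    { len    = len
    ; at     = at ∘ opposite
    ; at-inj = λ {i} {j} eq → trans (sym (Fin.opposite-involutive i))
                 (trans (cong opposite (at-inj eq)) (Fin.opposite-involutive j))
    ; start  = end
    ; end    = trans (cong at (Fin.opposite-involutive zero)) start
    ; step   = λ i → adj-sym T (subst (λ j → Adj T (at (inject₁ (opposite i))) (at j))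
                 (sym (opposite-inject₁ i)) (step (opposite i)))
    ; inside = inside ∘ opposite
    } where open Path p

  cons : ∀ {xs v u w} → v ∉ˡ xs → Adj T v u → Path xs u w → Path (v ∷ xs) v w
  cons {xs} {v} {u} v∉ adj p = record
    { len = suc len ; at = at′ ; at-inj = λ {i} {j} → at′-inj i j ; start = refl ; end = end
    ; step = step′ ; inside = inside′ }
    where
    open Path p
    at′ : Fin (suc (suc len)) → Fin t
    at′ zero    = v
    at′ (suc i) = at i
    at′-inj : ∀ i j → at′ i ≡ at′ j → i ≡ j
    at′-inj zero    zero    _  = refl
    at′-inj zero    (suc j) eq = contradiction (subst (_∈ˡ xs) (sym eq) (inside j)) v∉
    at′-inj (suc i) zero    eq = contradiction (subst (_∈ˡ xs) eq (inside i)) v∉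
    at′-inj (suc i) (suc j) eq = cong suc (at-inj eq)
    step′ : ∀ i → Adj T (at′ (inject₁ i)) (at′ (suc i))
    step′ zero    = subst (Adj T v) (sym start) adj
    step′ (suc i) = step i
    inside′ : ∀ i → at′ i ∈ˡ v ∷ xs
    inside′ zero    = here refl
    inside′ (suc i) = there (inside i)

  weaken : ∀ {xs v u w} → Path xs u w → Path (v ∷ xs) u w
  weaken p = record { Path p ; inside = there ∘ Path.inside p }

  point : ∀ {xs u} → u ∈ˡ xs → Path xs u u
  point {u = u} u∈ = record
    { len = 0 ; at = const u ; at-inj = λ { {zero} {zero} _ → refl } ; start = refl ; end = refl
    ; step = λ () ; inside = const u∈ }

  path : ∀ {xs} → Grown xs → ∀ {u w} → u ∈ˡ xs → w ∈ˡ xs → Path xs u w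
  path (root r) (here refl) (here refl) = point (here refl)
  path (grow _ _ _ _ _)      (here refl) (here refl) = point (here refl)
  path (grow g v∉ x∈ adj _)  (here refl) (there w∈)  = cons v∉ (adj-sym T adj) (path g x∈ w∈)
  path (grow g v∉ x∈ adj _)  (there u∈)  (here refl) = reverse (cons v∉ (adj-sym T adj) (path g x∈ u∈))
  path (grow g _ _ _ _)      (there u∈)  (there w∈)  = weaken (path g u∈ w∈)

  -- Two neighbours of `v` among the grown vertices are joined by a simple path avoiding `v`, which
  -- `v` closes up. As `x ≢ y`, the path has an edge, so the cycle has at least three vertices.
  cycle : ∀ {xs v x y} → Grown xs → v ∉ˡ xs → x ∈ˡ xs → y ∈ˡ xs → x ≢ y →
          Adj T x v → Adj T y v → Cycle T
  cycle {xs} {v} {x} {y} g v∉ x∈ y∈ x≢y x~v y~v = close (path g x∈ y∈)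
    where
    close : Path xs x y → Cycle T
    close p@record { len = zero } = contradiction (trans (sym (Path.start p)) (Path.end p)) x≢y
    close p@record { len = suc extra } = record
      { extra = extra ; visit = at ; simple = at-inj ; step = step
      ; closing = subst (λ u → Adj T u v) (sym end) y~v }
      where open Path (cons v∉ (adj-sym T x~v) p)

  Grown⇒Unique : ∀ {xs} → Grown xs → Unique xs
  Grown⇒Unique (root r)           = [] ∷ []
  Grown⇒Unique (grow g v∉ _ _ _) = All.¬Any⇒All¬ _ v∉ ∷ Grown⇒Unique g

  crossing : ∀ {xs u w} → Star (Adj T) u w → u ∈ˡ xs → w ∉ˡ xs → ∃[ x ] ∃[ y ] x ∈ˡ xs × y ∉ˡ xs × Adj T x y
  crossing ε u∈ w∉ = contradiction u∈ w∉
  crossing {xs} {u} (_◅_ {j = v} adj rest) u∈ w∉ with v ∈ˡ? xs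
  ... | yes v∈ = crossing rest v∈ w∉
  ... | no  v∉ = u , v , u∈ , v∉ , adj

  inhabited : ∀ {xs} → Grown xs → ∃[ r ] r ∈ˡ xs
  inhabited (root r)         = r , here refl
  inhabited (grow _ _ _ _ _) = _ , here refl

  -- `j` is fuel bounding the number of missing vertices. While one is missing, connectedness gives
  -- an edge leaving the list, and acyclicity makes its inner end the only neighbour of the new
  -- vertex.
  spanning : Connected T → ¬ Cycle T → ∀ j {xs} → Grown xs → t ≤ j + length xs → ∃[ ys ] Grown ys × ∀ v → v ∈ˡ ys
  spanning conn acyc j {xs} g t≤ with Fin.any? (λ v → ¬? (v ∈ˡ? xs))
  ... | no  none = xs , g , λ v → decidable-stable (v ∈ˡ? xs) λ v∉ → none (v , v∉)
  spanning conn acyc zero {xs} g t≤ | yes (v , v∉) = contradiction t≤ (ℕ.<⇒≱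
    (subst (length (v ∷ xs) ≤_) (List.length-tabulate id)
      (unique-length-≤ (All.¬Any⇒All¬ _ v∉ ∷ Grown⇒Unique g) λ _ → ListMem.∈-allFin _)))
  spanning conn acyc (suc j) {xs} g t≤ | yes (v , v∉)
    with r , r∈ ← inhabited g
    with x , y , x∈ , y∉ , adj ← crossing (conn r v) r∈ v∉ =
      spanning conn acyc j
        (grow g y∉ x∈ adj λ {z} z∈ adj′ → decidable-stable (z Fin.≟ x) λ z≢x →
          acyc (cycle g y∉ z∈ x∈ z≢x adj′ adj))
        (subst (t ≤_) (sym (ℕ.+-suc j (length xs))) t≤)

  tree⇒Grown : IsTree T → ∃[ xs ] Grown xs × ∀ v → v ∈ˡ xs
  tree⇒Grown tree = spanning connected acyclic t (root (fromℕ< nonempty)) (ℕ.m≤m+n t 1)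
    where open IsTree tree

  -- For C inside xs this is connectedness in T, in a form suited to induction on g.
  Conn : ∀ {xs} → Grown xs → Subset t → Set
  Conn (root r) C = ⊤
  Conn (grow {xs} {v} {x} g _ _ _ _) C = (v ∈ C → x ∈ C ⊎ All (_∉ C) xs) × Conn g C

  conn? : ∀ {xs} (g : Grown xs) → Decidable (Conn g)
  conn? (root r) C = yes tt
  conn? (grow {xs} {v} {x} g _ _ _ _) C =
    ((v ∈? C) →-dec ((x ∈? C) ⊎-dec All.all? (λ y → ¬? (y ∈? C)) xs)) ×-dec conn? g C

  conn-resp : ∀ {xs} (g : Grown xs) {C C′} → (∀ {y} → y ∈ˡ xs → y ∈ C → y ∈ C′) →
              (∀ {y} → y ∈ˡ xs → y ∈ C′ → y ∈ C) → Conn g C → Conn g C′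
  conn-resp (root r) to from _ = tt
  conn-resp (grow {xs} {v} {x} g _ x∈ _ _) {C} {C′} to from (top , c) = top′ , conn-resp g (to ∘ there) (from ∘ there) c
    where
    top′ : v ∈ C′ → x ∈ C′ ⊎ All (_∉ C′) xs
    top′ v∈ with top (from (here refl) v∈)
    ... | inj₁ x∈C  = inj₁ (to (there x∈) x∈C)
    ... | inj₂ none = inj₂ (All.tabulate λ y∈ y∈C′ → All.lookup none y∈ (from (there y∈) y∈C′))

  -- The Helly property of subtrees, as a duality between covering and packing.
  Hit : (Subset t → Set) → Vec (Fin t) k → Set
  Hit 𝒲 U = ∀ C → 𝒲 C → ∃[ i ] lookup U i ∈ C

  record Packing (xs : List (Fin t)) (𝒲 : Subset t → Set) (k : ℕ) : Set where
    constructor packing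
    field
      member   : Fin k → Subset t
      member∈  : ∀ i → 𝒲 (member i)
      disjoint : ∀ {i j v} → i ≢ j → v ∈ˡ xs → v ∈ member i → v ∉ member j

  -- Induction on the newest leaf `v`. If no member meets the tree in `v` alone, each member
  -- containing `v` contains its parent, so members disjoint on the older part are disjoint at `v`
  -- too. Otherwise `v` goes into the cover, and induction with `k` lowered by one treats the
  -- members avoiding `v`; a packing of those is enlarged by the member that meets the tree only in
  -- `v`.
  helly : ∀ {xs} (g : Grown xs) k {𝒲} → Decidable 𝒲 → (∀ {C} → 𝒲 C → Conn g C × Any (_∈ C) xs) →
          (∃[ U ] Hit {k} 𝒲 U) ⊎ Packing xs 𝒲 (suc k)
  helly (root r) (suc k) 𝒲? ok = inj₁ (Vec.replicate _ r , λ C w → zero , only (proj₂ (ok w)))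
    where
    only : ∀ {C} → Any (_∈ C) (r ∷ []) → r ∈ C
    only (here r∈) = r∈
  helly (root r) zero 𝒲? ok with anySubset? 𝒲?
  ... | yes (C , w) = inj₂ (packing (const C) (const w) λ { {zero} {zero} i≢j → contradiction refl i≢j })
  ... | no  none    = inj₁ ([] , λ C w → contradiction (C , w) none)
  helly (grow {xs} {v} {x} g v∉ x∈ adj only) k {𝒲} 𝒲? ok
    with anySubset? (λ C → 𝒲? C ×-dec All.all? (λ y → ¬? (y ∈? C)) xs)
  ... | no none = liftPacking (helly g k 𝒲? λ {C} w → proj₂ (proj₁ (ok w)) , meets w)
    where
    meets : ∀ {C} → 𝒲 C → Any (_∈ C) xs
    meets {C} w = decidable-stable (Any.any? (_∈? C) xs) λ ¬any → none (C , w , All.¬Any⇒All¬ xs ¬any)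

    liftPacking : (∃[ U ] Hit {k} 𝒲 U) ⊎ Packing xs 𝒲 (suc k) → (∃[ U ] Hit {k} 𝒲 U) ⊎ Packing (v ∷ xs) 𝒲 (suc k)
    liftPacking (inj₁ hit) = inj₁ hit
    liftPacking (inj₂ (packing M M∈ dis)) = inj₂ (packing M M∈ dis′)
      where
      parent : ∀ i → v ∈ M i → x ∈ M i
      parent i v∈ with proj₁ (proj₁ (ok (M∈ i))) v∈
      ... | inj₁ x∈M  = x∈M
      ... | inj₂ away = contradiction (M i , M∈ i , away) none
      dis′ : ∀ {i j w} → i ≢ j → w ∈ˡ v ∷ xs → w ∈ M i → w ∉ M j
      dis′ {i} {j} i≢j (here refl) v∈i v∈j = dis i≢j x∈ (parent i v∈i) (parent j v∈j)
      dis′ i≢j (there w∈) = dis i≢j w∈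
  helly (grow {xs} {v} {x} g v∉ x∈ adj only) zero {𝒲} 𝒲? ok | yes (C , w , _) =
    inj₂ (packing (const C) (const w) λ { {zero} {zero} i≢j → contradiction refl i≢j })
  helly (grow {xs} {v} {x} g v∉ x∈ adj only) (suc k) {𝒲} 𝒲? ok | yes (C , w , C≡v) =
    extend (helly g k {𝒲′} (λ C → 𝒲? C ×-dec ¬? (v ∈? C)) λ (w , v∉C) → proj₂ (proj₁ (ok w)) , avoid (proj₂ (ok w)) v∉C)
    where
    𝒲′ : Subset t → Set
    𝒲′ C = 𝒲 C × v ∉ C
    avoid : ∀ {C} → Any (_∈ C) (v ∷ xs) → v ∉ C → Any (_∈ C) xs
    avoid (here v∈) v∉C = contradiction v∈ v∉C
    avoid (there y∈) _ = y∈
    extend : (∃[ U ] Hit {k} 𝒲′ U) ⊎ Packing xs 𝒲′ (suc k) →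
             (∃[ U ] Hit {suc k} 𝒲 U) ⊎ Packing (v ∷ xs) 𝒲 (suc (suc k))
    extend (inj₁ (U , hit)) = inj₁ (v ∷ U , hit′)
      where
      hit′ : Hit 𝒲 (v ∷ U)
      hit′ C′ w′ with v ∈? C′
      ... | yes v∈ = zero , v∈
      ... | no  v∉C′ = let i , u∈ = hit C′ (w′ , v∉C′) in suc i , u∈
    extend (inj₂ (packing M M∈ dis)) = inj₂ (packing M′ M′∈ (λ {i} {j} → dis′ i j))
      where
      M′ : Fin (suc (suc k)) → Subset t
      M′ zero    = C
      M′ (suc i) = M i
      M′∈ : ∀ i → 𝒲 (M′ i)
      M′∈ zero    = w
      M′∈ (suc i) = proj₁ (M∈ i)
      dis′ : ∀ i j {u} → i ≢ j → u ∈ˡ v ∷ xs → u ∈ M′ i → u ∉ M′ j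
      dis′ zero    zero    i≢j _           _   _   = i≢j refl
      dis′ zero    (suc j) _   (here refl) _   v∈j = proj₂ (M∈ j) v∈j
      dis′ zero    (suc j) _   (there u∈)  u∈C _   = All.lookup C≡v u∈ u∈C
      dis′ (suc i) zero    _   (here refl) v∈i _   = proj₂ (M∈ i) v∈i
      dis′ (suc i) zero    _   (there u∈)  _   u∈C = All.lookup C≡v u∈ u∈C
      dis′ (suc i) (suc j) _   (here refl) v∈i _   = proj₂ (M∈ i) v∈i
      dis′ (suc i) (suc j) i≢j (there u∈)          = dis (i≢j ∘ cong suc) u∈

  -- Components of induced subforests

  record Component {xs} (g : Grown xs) (W : Subset t) : Set where
    field
      piece    : Subset t
      conn     : Conn g piece
      meets    : Any (_∈ piece) xs
      ⊆W       : ∀ {v} → v ∈ piece → v ∈ W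
      ⊆xs      : ∀ {v} → v ∈ piece → v ∈ˡ xs
      closed   : ∀ {u w} → u ∈ piece → w ∈ˡ xs → w ∈ W → Adj T u w → w ∈ piece

  isolated : ∀ {xs} (g : Grown xs) {v} → v ∉ˡ xs → Conn g ⁅ v ⁆
  isolated (root r) v∉ = tt
  isolated (grow {v = u} g _ _ _ _) {v} v∉ =
    (λ u∈ → contradiction (here (sym (x∈⁅y⁆⇒x≡y v u∈))) v∉) , isolated g (v∉ ∘ there)

  -- Only the newest leaf `v` needs a decision. If `W` misses the older vertices, `v` is a component
  -- by itself. Otherwise a component `C` of the older part is taken, and `v` joins it precisely
  -- when `v` is in `W` and its parent in `C`, the parent being the only link from `v` to the older
  -- part.
  component : ∀ {xs} (g : Grown xs) W → Any (_∈ W) xs → Component g W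
  component (root r) W (here r∈) = record
    { piece = ⁅ r ⁆ ; conn = tt ; meets = here (x∈⁅x⁆ r)
    ; ⊆W = λ v∈ → subst (_∈ W) (sym (x∈⁅y⁆⇒x≡y r v∈)) r∈ ; ⊆xs = λ v∈ → here (x∈⁅y⁆⇒x≡y r v∈)
    ; closed = λ { _ (here refl) _ _ → x∈⁅x⁆ r } }
  component (grow {xs} {v} {x} g v∉ x∈ adj only) W any with Any.any? (_∈? W) xs
  ... | no none = record
    { piece = ⁅ v ⁆ ; conn = (λ _ → inj₂ (All.tabulate λ y∈ y∈v → v∉ (subst (_∈ˡ xs) (x∈⁅y⁆⇒x≡y v y∈v) y∈))) , isolated g v∉
    ; meets = here (x∈⁅x⁆ v)
    ; ⊆W = λ u∈ → subst (_∈ W) (sym (x∈⁅y⁆⇒x≡y v u∈)) (v∈W any) ; ⊆xs = λ u∈ → here (x∈⁅y⁆⇒x≡y v u∈)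
    ; closed = λ { _ (here refl) _ _ → x∈⁅x⁆ v ; _ (there w∈) w∈W _ → contradiction (lose w∈ w∈W) none } }
    where
    v∈W : Any (_∈ W) (v ∷ xs) → v ∈ W
    v∈W (here v∈)   = v∈
    v∈W (there any) = contradiction any none
  ... | yes some with component g W some
  ...   | record { piece = C ; conn = conn ; meets = meets ; ⊆W = ⊆W ; ⊆xs = ⊆xs ; closed = closed }
    with v ∈? W | x ∈? C
  ...   | yes v∈W | yes x∈C = record
    { piece = C⁺ ; conn = (λ _ → inj₁ (⁺ x∈C)) , conn-resp g (λ _ → ⁺) (λ {y} y∈ → λ y∈C⁺ → old y∈ (⁻ y∈C⁺)) conn
    ; meets = there (Any.map ⁺ meets)
    ; ⊆W = λ u∈ → in-W (⁻ u∈) ; ⊆xs = λ u∈ → in-xs (⁻ u∈) ; closed = λ u∈ → closed′ (⁻ u∈) }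
    where
    C⁺? : Decidable (λ y → y ∈ C ⊎ y ≡ v)
    C⁺? y = (y ∈? C) ⊎-dec (y Fin.≟ v)
    C⁺ : Subset t
    C⁺ = ⟦ C⁺? ⟧
    ⁺ : ∀ {y} → y ∈ C → y ∈ C⁺
    ⁺ y∈ = ∈⟦⟧⁺ C⁺? (inj₁ y∈)
    ⁻ : ∀ {y} → y ∈ C⁺ → y ∈ C ⊎ y ≡ v
    ⁻ = ∈⟦⟧⁻ C⁺?
    old : ∀ {y} → y ∈ˡ xs → y ∈ C ⊎ y ≡ v → y ∈ C
    old y∈ (inj₁ y∈C)  = y∈C
    old y∈ (inj₂ refl) = contradiction y∈ v∉
    in-W : ∀ {y} → y ∈ C ⊎ y ≡ v → y ∈ W
    in-W (inj₁ y∈C)  = ⊆W y∈C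
    in-W (inj₂ refl) = v∈W
    in-xs : ∀ {y} → y ∈ C ⊎ y ≡ v → y ∈ˡ v ∷ xs
    in-xs (inj₁ y∈C)  = there (⊆xs y∈C)
    in-xs (inj₂ refl) = here refl
    closed′ : ∀ {u w} → u ∈ C ⊎ u ≡ v → w ∈ˡ v ∷ xs → w ∈ W → Adj T u w → w ∈ C⁺
    closed′ _           (here refl) _   _    = ∈⟦⟧⁺ C⁺? (inj₂ refl)
    closed′ (inj₁ u∈C)  (there w∈)  w∈W u~w  = ⁺ (closed u∈C w∈ w∈W u~w)
    closed′ (inj₂ refl) (there w∈)  w∈W v~w  = ⁺ (subst (_∈ C) (sym (only w∈ (adj-sym T v~w))) x∈C)
  ...   | yes v∈W | no x∉C = record
    { piece = C ; conn = (λ v∈ → contradiction (⊆xs v∈) v∉) , conn ; meets = there meets ; ⊆W = ⊆W ; ⊆xs = there ∘ ⊆xs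
    ; closed = λ { u∈ (here refl) _ u~v → contradiction (subst (_∈ C) (only (⊆xs u∈) u~v) u∈) x∉C
                 ; u∈ (there w∈) w∈W u~w → closed u∈ w∈ w∈W u~w } }
  ...   | no v∉W | _ = record
    { piece = C ; conn = (λ v∈ → contradiction (⊆xs v∈) v∉) , conn ; meets = there meets ; ⊆W = ⊆W ; ⊆xs = there ∘ ⊆xs
    ; closed = λ { u∈ (here refl) v∈W _ → contradiction v∈W v∉W
                 ; u∈ (there w∈) w∈W u~w → closed u∈ w∈ w∈W u~w } }

-- Greedy embedding into a subgraph of large minimum degree

record Core (G : Graph n) (Q : ℕ) : Set where
  field
    inner    : Subset n
    nonempty : Nonempty inner
    rich     : ∀ {x} → x ∈ inner → ∃[ ys ] Unique ys × Q ≤ length ys × All (λ y → y ∈ inner × Adj G x y) ys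

module _ (T : Graph t) (G : Graph n) {Q : ℕ} (core : Core G Q) (t<Q : t < Q) where
  open Core core

  record EmbedsOn (xs : List (Fin t)) (f : Fin t → Fin n) : Set where
    constructor embedsOn
    field
      in-core   : ∀ {u} → u ∈ˡ xs → f u ∈ inner
      injective : ∀ {u w} → u ∈ˡ xs → w ∈ˡ xs → f u ≡ f w → u ≡ w
      preserves : ∀ {u w} → u ∈ˡ xs → w ∈ˡ xs → Adj T u w → Adj G (f u) (f w)

  embed-in-core : ∀ {xs} → Grown T xs → ∃ (EmbedsOn xs)
  embed-in-core (root r) = const (proj₁ nonempty) , embedsOn (λ _ → proj₂ nonempty)
    (λ { (here refl) (here refl) _ → refl })
    (λ { (here refl) (here refl) r~r → contradiction refl (adj-irrefl T r~r) })
  embed-in-core (grow {xs} {v} {x} g v∉ x∈ x~v only)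
    with f , embedsOn in-core inj pres ← embed-in-core g
    with ys , ys! , Q≤ , all-ys ← rich (in-core x∈)
    -- The image of the parent has more than `t` neighbours in the core. The list to avoid also
    -- contains the arbitrary values of `f` at vertices not yet placed, but its length is `t` all
    -- the same.
    with y , y∈ , y∉ ← fresh Fin._≟_ ys (List.tabulate f) ys!
                          (ℕ.<-≤-trans (subst (_< Q) (sym (List.length-tabulate f)) t<Q) Q≤) =
      f′ , embedsOn in-core′ inj′ pres′
    where
    f′ : Fin t → Fin n
    f′ = updateAt f v (const y)
    new : f′ v ≡ y
    new = updateAt-updates v f
    old : ∀ {u} → u ∈ˡ xs → f′ u ≡ f u
    old {u} u∈ = updateAt-minimal u v f λ { refl → v∉ u∈ }
    y-fresh : ∀ {u} → f u ≢ y
    y-fresh refl = y∉ (ListMem.∈-tabulate⁺ {f = f} _)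
    in-core′ : ∀ {u} → u ∈ˡ v ∷ xs → f′ u ∈ inner
    in-core′ (here refl) = subst (_∈ inner) (sym new) (proj₁ (All.lookup all-ys y∈))
    in-core′ (there u∈)  = subst (_∈ inner) (sym (old u∈)) (in-core u∈)
    inj′ : ∀ {u w} → u ∈ˡ v ∷ xs → w ∈ˡ v ∷ xs → f′ u ≡ f′ w → u ≡ w
    inj′ (here refl) (here refl) _  = refl
    inj′ (here refl) (there w∈)  eq = contradiction (trans (sym (old w∈)) (trans (sym eq) new)) y-fresh
    inj′ (there u∈)  (here refl) eq = contradiction (trans (sym (old u∈)) (trans eq new)) y-fresh
    inj′ (there u∈)  (there w∈)  eq = inj u∈ w∈ (trans (sym (old u∈)) (trans eq (old w∈)))
    x~y : Adj G (f x) y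
    x~y = proj₂ (All.lookup all-ys y∈)
    pres′ : ∀ {u w} → u ∈ˡ v ∷ xs → w ∈ˡ v ∷ xs → Adj T u w → Adj G (f′ u) (f′ w)
    pres′ (here refl) (here refl) v~v = contradiction refl (adj-irrefl T v~v)
    pres′ {w = w} (here refl) (there w∈) v~w =
      subst₂ (Adj G) (sym new) (sym (old w∈))
        (adj-sym G (subst (λ z → Adj G (f z) y) (sym (only w∈ (adj-sym T v~w))) x~y))
    pres′ (there u∈) (here refl) u~v =
      subst₂ (Adj G) (sym (old u∈)) (sym new) (subst (λ z → Adj G (f z) y) (sym (only u∈ u~v)) x~y)
    pres′ (there u∈) (there w∈) u~w = subst₂ (Adj G) (sym (old u∈)) (sym (old w∈)) (pres u∈ w∈ u~w)

-- Petals and blow-ups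

record Petals (T : Graph t) (G : Graph n) (D : ℕ) (φ : Fin t → Fin n) (C : Subset t) : Set where
  field
    petal     : Fin D → Fin t → Fin n
    embedding : ∀ d → IsEmbedding T G (petal d)
    outside   : ∀ d {v} → v ∉ C → petal d v ≡ φ v
    disjoint  : ∀ {d e} → d ≢ e → ∀ {v w} → v ∈ C → w ∈ C → petal d v ≢ petal e w

record Separated (T : Graph t) (C : Fin s → Subset t) : Set where
  field
    nonempty : ∀ a → Nonempty (C a)
    disjoint : ∀ {a b} → a ≢ b → ∀ {v} → v ∈ C a → v ∉ C b
    apart    : ∀ {a b} → a ≢ b → ∀ {u w} → u ∈ C a → w ∈ C b → ¬ Adj T u w

-- The vertices labelled nothing form the kernel; deleting it leaves at least s
-- components, since labels are constant on components.
record BlowUp (T : Graph t) (G : Graph n) (s m : ℕ) : Set where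
  field
    label    : Fin t → Maybe (Fin s)
    onto     : ∀ a → ∃[ v ] label v ≡ just a
    coherent : ∀ {u w a b} → Adj T u w → label u ≡ just a → label w ≡ just b → a ≡ b
    place    : Fin m → Fin t → Fin n
    kernel   : ∀ {i j v} → label v ≡ nothing → place i v ≡ place j v
    separate : ∀ {i j u w} → place i u ≡ place j w → u ≡ w × (∀ {a} → label u ≡ just a → i ≡ j)
    adjacent : ∀ {i u w} → Adj T u w → Adj G (place i u) (place i w)

module _ {T : Graph t} {G : Graph n} {φ : Fin t → Fin n} (φ-emb : IsEmbedding T G φ)
         {C : Fin s → Subset t} (sep : Separated T C) (petals : ∀ a → Petals T G D φ (C a)) where
  private
    module Sep = Separated sep
    petal : Fin s → Fin D → Fin t → Fin n
    petal a = Petals.petal (petals a)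
    module Emb a d = IsEmbedding (Petals.embedding (petals a) d)

    Clash : ∀ a → Fin D → ∀ b → Fin D → Set
    Clash a d b e = ∃[ v ] ∃[ w ] v ∈ C a × w ∈ C b × petal a d v ≡ petal b e w

    Choice : ∀ N → (Fin N → Fin s) → Set
    Choice N slot = ∃ λ (g : Fin N → Fin D) → ∀ {x y} → x ≢ y → ¬ Clash (slot x) (g x) (slot y) (g y)

    -- Slots are filled one after another. The petals chosen so far occupy at most `N * t` vertices,
    -- and each of these spoils at most one index for the new slot, since different petals of one
    -- `C a` are disjoint there.
    choose : ∀ N (slot : Fin N → Fin s) → N * t < D → Choice N slot
    choose zero    slot _    = (λ ()) , λ { {()} }
    choose (suc N) slot N*t< with choose N (slot ∘ suc) (ℕ.≤-<-trans (ℕ.m≤n+m (N * t) t) N*t<)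
    ... | g , ok = extend free
      where
      c : Fin s
      c = slot zero
      used : Fin (N * t) → Fin n
      used z = let j , w = remQuot t z in petal (slot (suc j)) (g j) w
      Meets : Fin D → Set
      Meets d = ∃[ z ] ∃[ v ] v ∈ C c × petal c d v ≡ used z
      meets? : Decidable Meets
      meets? d = Fin.any? λ z → Fin.any? λ v → (v ∈? C c) ×-dec (petal c d v Fin.≟ used z)
      not-all : ¬ (∀ d → Meets d)
      not-all hits with Fin.pigeonhole (ℕ.≤-<-trans (ℕ.m≤n+m (N * t) t) N*t<) (proj₁ ∘ hits)
      ... | d , e , d<e , eq with hits d | hits e
      ...   | z , v , v∈ , p | z′ , w , w∈ , q = Petals.disjoint (petals c) (Fin.<⇒≢ d<e) v∈ w∈
                (trans p (trans (cong used eq) (sym q)))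
      free : ∃[ d ] ¬ Meets d
      free = Fin.¬∀⟶∃¬ D Meets meets? not-all
      extend : ∃[ d ] ¬ Meets d → Choice (suc N) slot
      extend (d , ¬hit) = g′ , λ {x} {y} → ok′ x y
        where
        g′ : Fin (suc N) → Fin D
        g′ zero    = d
        g′ (suc j) = g j
        no-clash : ∀ j → ¬ Clash c d (slot (suc j)) (g j)
        no-clash j (v , w , v∈ , _ , eq) = ¬hit (combine j w , v , v∈ ,
          trans eq (cong (λ (i , u) → petal (slot (suc i)) (g i) u) (sym (Fin.remQuot-combine j w))))
        ok′ : ∀ x y → x ≢ y → ¬ Clash (slot x) (g′ x) (slot y) (g′ y)
        ok′ zero    zero    x≢y = contradiction refl x≢y
        ok′ zero    (suc j) _   = no-clash j
        ok′ (suc i) zero    _ (v , w , v∈ , w∈ , eq) = no-clash i (w , v , w∈ , v∈ , sym eq)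
        ok′ (suc i) (suc j) x≢y = ok (x≢y ∘ cong suc)

    label : Fin t → Maybe (Fin s)
    label v with Fin.any? (λ a → v ∈? C a)
    ... | yes (a , _) = just a
    ... | no  _       = nothing

    label-just : ∀ {v a} → label v ≡ just a → v ∈ C a
    label-just {v} eq with Fin.any? (λ a → v ∈? C a)
    label-just refl | yes (_ , v∈) = v∈

    label-nothing : ∀ {v} → label v ≡ nothing → ∀ a → v ∉ C a
    label-nothing {v} eq a v∈ with Fin.any? (λ a → v ∈? C a)
    ... | no none = none (a , v∈)

    label-∈ : ∀ {v a} → v ∈ C a → label v ≡ just a
    label-∈ {v} {a} v∈ with Fin.any? (λ a → v ∈? C a)
    ... | no none = contradiction (a , v∈) none
    ... | yes (b , v∈b) = cong just (decidable-stable (b Fin.≟ a) λ b≢a → Sep.disjoint b≢a v∈b v∈)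

  -- The slot `combine a i` holds the petal that moves `C a` in copy `i`; the kernel stays where `φ`
  -- puts it. The absence of clashes keeps the copies apart, and because the sets `C a` are pairwise
  -- nonadjacent, every edge of `T` is seen by a single petal or by `φ`.
  assemble : s * m * t < D → BlowUp T G s m
  assemble {m} bound with choose (s * m) (proj₁ ∘ remQuot {s} m) bound
  ... | g , ok = record
    { label = label ; onto = λ a → let v , v∈ = Sep.nonempty a in v , label-∈ v∈ ; coherent = coherent
    ; place = λ i v → at i v (label v) ; kernel = λ {i} {j} {v} → kernel i j v
    ; separate = λ {i} {j} {u} {w} → separate i j u w (label u) refl (label w) refl
    ; adjacent = λ {i} {u} {w} u~w → adjacent i u~w (label u) refl (label w) refl }
    where
    choice : Fin s → Fin m → Fin D
    choice a i = g (combine a i)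
    at : Fin m → Fin t → Maybe (Fin s) → Fin n
    at i v (just a) = petal a (choice a i) v
    at i v nothing  = φ v

    outside : ∀ a d {v} → v ∉ C a → petal a d v ≡ φ v
    outside a d = Petals.outside (petals a) d

    no-clash : ∀ a i b j → combine a i ≢ combine b j → ¬ Clash a (choice a i) b (choice b j)
    no-clash a i b j distinct clash = ok distinct (subst₂ (λ a′ b′ → Clash a′ (choice a i) b′ (choice b j))
      (cong proj₁ (sym (Fin.remQuot-combine a i))) (cong proj₁ (sym (Fin.remQuot-combine b j))) clash)

    coherent : ∀ {u w a b} → Adj T u w → label u ≡ just a → label w ≡ just b → a ≡ b
    coherent {a = a} {b} u~w p q = decidable-stable (a Fin.≟ b) λ a≢b →
      Sep.apart a≢b (label-just p) (label-just q) u~w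

    kernel : ∀ i j v → label v ≡ nothing → at i v (label v) ≡ at j v (label v)
    kernel i j v eq rewrite eq = refl

    separate : ∀ i j u w lu → label u ≡ lu → ∀ lw → label w ≡ lw → at i u lu ≡ at j w lw →
               u ≡ w × (∀ {a} → lu ≡ just a → i ≡ j)
    separate i j u w nothing  p nothing  q eq = IsEmbedding.injective φ-emb eq , λ ()
    -- Off `C a` the petal agrees with `φ`, so both sides are values of one petal, which is
    -- injective.
    separate i j u w (just a) p nothing  q eq
      with refl ← Emb.injective a (choice a i) (trans eq (sym (outside a (choice a i) (label-nothing q a)))) =
        contradiction (label-just p) (label-nothing q a)
    separate i j u w nothing  p (just b) q eq
      with refl ← Emb.injective b (choice b j) (trans (outside b (choice b j) (label-nothing p b)) eq) =
        contradiction (label-just q) (label-nothing p b)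
    separate i j u w (just a) p (just b) q eq with combine a i Fin.≟ combine b j
    ... | no distinct = contradiction (u , w , label-just p , label-just q , eq) (no-clash a i b j distinct)
    ... | yes same with refl , refl ← Fin.combine-injective a i b j same =
      Emb.injective a (choice a i) eq , λ _ → refl

    adjacent : ∀ i {u w} → Adj T u w → ∀ lu → label u ≡ lu → ∀ lw → label w ≡ lw → Adj G (at i u lu) (at i w lw)
    adjacent i u~w nothing  p nothing  q = IsEmbedding.preserves φ-emb u~w
    adjacent i u~w (just a) p nothing  q =
      subst (Adj G _) (outside a (choice a i) (label-nothing q a)) (Emb.preserves a (choice a i) u~w)
    adjacent i {w = w} u~w nothing p (just b) q =
      subst (λ x → Adj G x (petal b (choice b i) w)) (outside b (choice b i) (label-nothing p b))
        (Emb.preserves b (choice b i) u~w)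
    adjacent i u~w (just a) p (just b) q with refl ← coherent u~w p q = Emb.preserves a (choice a i) u~w

-- Ranks in degenerate graphs

record Ranked (G : Graph n) (Q : ℕ) (X : Subset n) : Set where
  field
    rank : Fin n → ℕ
    few  : ∀ {x} → x ∈ X → ∀ {ys} → Unique ys → All (λ y → y ∈ X × Adj G x y × rank x ≤ rank y) ys → length ys < Q

-- Vertices with fewer than `Q` neighbours in the remaining set are peeled off, `j` bounding its
-- size. When none can be peeled, the remaining set is a core.
degenerate : (G : Graph n) (Q : ℕ) → ∀ j (X : Subset n) → ∣ X ∣ ≤ j → Core G Q ⊎ Ranked G Q X
degenerate G Q j X ∣X∣≤j with nonempty? X
... | no  empty = inj₂ record { rank = const 0 ; few = λ x∈ → contradiction (_ , x∈) empty }
degenerate G Q zero    X ∣X∣≤j | yes (_ , x∈X) = contradiction (ℕ.<-≤-trans (∣∖∣< x∈X) ∣X∣≤j) λ ()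
degenerate {n} G Q (suc j) X ∣X∣≤j | yes nonempty = peel (Fin.any? λ x → (x ∈? X) ×-dec (length (nbrs x) ℕ.<? Q))
  where
  nbr? : ∀ x → Decidable (λ y → y ∈ X × Adj G x y)
  nbr? x y = (y ∈? X) ×-dec (y ∈? _)
  nbrs : Fin n → List (Fin n)
  nbrs x = filter (nbr? x) (allFin n)

  peel : Dec (∃[ x ] x ∈ X × length (nbrs x) < Q) → Core G Q ⊎ Ranked G Q X
  peel (no none) = inj₁ record
    { inner = X ; nonempty = nonempty
    ; rich = λ {x} x∈ → nbrs x , Unique.filter⁺ (nbr? x) (Unique.allFin⁺ n) ,
                        ℕ.≮⇒≥ (λ few → none (x , x∈ , few)) , All.all-filter (nbr? x) (allFin n) }
  peel (yes (x , x∈ , few-x)) with degenerate G Q j (X ∖ x) (ℕ.≤-pred (ℕ.<-≤-trans (∣∖∣< x∈) ∣X∣≤j))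
  ... | inj₁ core = inj₁ core
  ... | inj₂ record { rank = ρ ; few = few } = inj₂ record { rank = ρ′ ; few = λ {y} → few′ y (y Fin.≟ x) }
    where
    -- The peeled vertex gets the lowest rank: all its neighbours in `X` count against it, but they
    -- are few, and it does not count against the vertices that remain.
    at : ∀ y → Dec (y ≡ x) → ℕ
    at y (yes _) = 0
    at y (no _)  = suc (ρ y)
    ρ′ : Fin n → ℕ
    ρ′ y = at y (y Fin.≟ x)
    later : ∀ {y z} → z ∈ X × Adj G y z × suc (ρ y) ≤ ρ′ z → z ∈ X ∖ x × Adj G y z × ρ y ≤ ρ z
    later {z = z} (z∈ , y~z , ρ≤) with z Fin.≟ x
    ... | yes _  = contradiction ρ≤ λ ()
    ... | no z≢x = ∈∖⁺ z∈ z≢x , y~z , ℕ.≤-pred ρ≤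
    few′ : ∀ y (d : Dec (y ≡ x)) → y ∈ X → ∀ {ys} → Unique ys →
           All (λ z → z ∈ X × Adj G y z × at y d ≤ ρ′ z) ys → length ys < Q
    few′ y (yes refl) y∈ u all = ℕ.≤-<-trans
      (unique-length-≤ u λ z∈ → let z∈X , y~z , _ = All.lookup all z∈ in
         ListMem.∈-filter⁺ (nbr? y) (ListMem.∈-allFin _) (z∈X , y~z)) few-x
    few′ y (no y≢x) y∈ u all = few (∈∖⁺ y∈ y≢x) u (All.map later all)

-- Leaves

∣p∣≡1⇒singleton : (p : Subset n) → ∣ p ∣ ≡ 1 → ∃[ x ] x ∈ p × ∀ {y} → y ∈ p → y ≡ x
∣p∣≡1⇒singleton {n} p eq with nonempty? p
... | no empty = contradiction (trans (sym eq) (trans (cong ∣_∣ (Empty-unique empty)) (∣⊥∣≡0 n))) λ ()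
... | yes (x , x∈) = x , x∈ , λ {y} y∈ → decidable-stable (y Fin.≟ x) λ y≢x → ℕ.n≮0
  (ℕ.<-≤-trans (∣∖∣< (∈∖⁺ y∈ y≢x)) (ℕ.≤-pred (subst (∣ p ∖ x ∣ <_) eq (∣∖∣< x∈))))

module _ (T : Graph t) where
  support : ∀ {v} → degree T v ≡ 1 → ∃[ x ] Adj T v x × ∀ {y} → Adj T v y → y ≡ x
  support = ∣p∣≡1⇒singleton _

  -- A walk can never leave a pair of adjacent leaves, so connectedness allows no other vertices.
  adjacent-leaves⇒K₂ : Connected T → ∀ {u w} → degree T u ≡ 1 → degree T w ≡ 1 → Adj T u w → T ≅ whole K₂
  adjacent-leaves⇒K₂ conn {u} {w} u-leaf w-leaf u~w = f , isIso (λ {i} {j} → inj i j (only i) (only j)) image adj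
    where
    sole : ∀ {x y z} → degree T x ≡ 1 → Adj T x y → Adj T x z → z ≡ y
    sole leaf x~y x~z = let _ , _ , uniq = support leaf in trans (uniq x~z) (sym (uniq x~y))
    reach : ∀ {x y} → x ≡ u ⊎ x ≡ w → Star (Adj T) x y → y ≡ u ⊎ y ≡ w
    reach x∈ ε = x∈
    reach (inj₁ refl) (x~y ◅ rest) = reach (inj₂ (sole u-leaf u~w x~y)) rest
    reach (inj₂ refl) (x~y ◅ rest) = reach (inj₁ (sole w-leaf (adj-sym T u~w) x~y)) rest
    only : ∀ y → y ≡ u ⊎ y ≡ w
    only y = reach (inj₁ refl) (conn u y)
    side : Fin t → Fin 2
    side y = if does (y Fin.≟ u) then zero else suc zero
    f : Vec (Fin 2) t
    f = Vec.tabulate side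
    w≢u : w ≢ u
    w≢u refl = adj-irrefl T u~w refl
    fu : lookup f u ≡ zero
    fu = trans (Vec.lookup∘tabulate side u) (cong (if_then zero else suc zero) (dec-true (u Fin.≟ u) refl))
    fw : lookup f w ≡ suc zero
    fw = trans (Vec.lookup∘tabulate side w) (cong (if_then zero else suc zero) (dec-false (w Fin.≟ u) w≢u))
    inj : ∀ i j → i ≡ u ⊎ i ≡ w → j ≡ u ⊎ j ≡ w → lookup f i ≡ lookup f j → i ≡ j
    inj _ _ (inj₁ refl) (inj₁ refl) _ = refl
    inj _ _ (inj₁ refl) (inj₂ refl) eq = contradiction (trans (sym fu) (trans eq fw)) λ ()
    inj _ _ (inj₂ refl) (inj₁ refl) eq = contradiction (trans (sym fu) (trans (sym eq) fw)) λ ()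
    inj _ _ (inj₂ refl) (inj₂ refl) _ = refl
    image : ∀ x → x ∈ ⊤ˢ ⇔ (∃[ i ] lookup f i ≡ x)
    image zero       = mk⇔ (const (u , fu)) (const ∈⊤)
    image (suc zero) = mk⇔ (const (w , fw)) (const ∈⊤)
    adj : ∀ i j → Adj T i j ⇔ lookup f j ∈ lookup (nbr K₂) (lookup f i)
    adj i j with only i | only j
    ... | inj₁ refl | inj₁ refl rewrite fu = mk⇔ (λ a → contradiction refl (adj-irrefl T a)) λ ()
    ... | inj₁ refl | inj₂ refl rewrite fu | fw = mk⇔ (const (Vec.there Vec.here)) (const u~w)
    ... | inj₂ refl | inj₁ refl rewrite fu | fw = mk⇔ (const Vec.here) (const (adj-sym T u~w))
    ... | inj₂ refl | inj₂ refl rewrite fw = mk⇔ (λ a → contradiction refl (adj-irrefl T a)) λ { (Vec.there ()) }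

-- The image of the neighbour of `v` has at least `D + t` neighbours in the core, of which `f` uses
-- at most `t`; the others are new places for `v`.
leaf-petals : (T : Graph t) (G : Graph n) (core : Core G (D + t)) →
  ∀ {f} → (∀ u → f u ∈ Core.inner core) → IsEmbedding T G f → ∀ {v} → degree T v ≡ 1 → Petals T G D f ⁅ v ⁆
leaf-petals {t} {n} {D} T G core {f} in-core emb {v} leaf
  with x , v~x , only-x ← support T leaf
  with ys , ys! , D+t≤ , all-ys ← Core.rich core (in-core x) = record
  { petal = λ d → updateAt f v (const (y d)) ; embedding = λ d → isEmbedding (injective d) (preserves d)
  ; outside = λ d u∉ → old d λ { refl → u∉ (x∈⁅x⁆ v) } ; disjoint = disjoint }
  where
  zs : List (Fin n)
  zs = filter (λ z → ¬? (DecMem._∈?_ Fin._≟_ z (List.tabulate f))) ys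
  zs! : Unique zs
  zs! = Unique.filter⁺ _ ys!
  D≤ : D ≤ length zs
  D≤ = ℕ.+-cancelʳ-≤ t D _ (ℕ.≤-trans D+t≤ (subst (λ l → length ys ≤ length zs + l) (List.length-tabulate f)
         (unique-avoid Fin._≟_ ys (List.tabulate f) ys!)))
  y : Fin D → Fin n
  y d = List.lookup zs (inject≤ d D≤)
  y∈ : ∀ d → y d ∈ˡ ys × y d ∉ˡ List.tabulate f
  y∈ d = ListMem.∈-filter⁻ _ {xs = ys} (ListMem.∈-lookup {xs = zs} (inject≤ d D≤))
  x~y : ∀ d → Adj G (f x) (y d)
  x~y d = proj₂ (All.lookup all-ys (proj₁ (y∈ d)))
  fresh-y : ∀ d u → f u ≢ y d
  fresh-y d u eq = proj₂ (y∈ d) (subst (_∈ˡ List.tabulate f) eq (ListMem.∈-tabulate⁺ {f = f} u))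
  petal : Fin D → Fin t → Fin n
  petal d = updateAt f v (const (y d))
  new : ∀ d → petal d v ≡ y d
  new d = updateAt-updates v f
  old : ∀ d {u} → u ≢ v → petal d u ≡ f u
  old d {u} u≢v = updateAt-minimal u v f u≢v
  injective : ∀ d {u w} → petal d u ≡ petal d w → u ≡ w
  injective d {u} {w} eq with u Fin.≟ v | w Fin.≟ v
  ... | yes refl | yes refl = refl
  ... | yes refl | no  w≢v  = contradiction (trans (sym (old d w≢v)) (trans (sym eq) (new d))) (fresh-y d w)
  ... | no  u≢v  | yes refl = contradiction (trans (sym (old d u≢v)) (trans eq (new d))) (fresh-y d u)
  ... | no  u≢v  | no  w≢v  = IsEmbedding.injective emb (trans (sym (old d u≢v)) (trans eq (old d w≢v)))
  preserves : ∀ d {u w} → Adj T u w → Adj G (petal d u) (petal d w)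
  preserves d {u} {w} u~w with u Fin.≟ v | w Fin.≟ v
  ... | yes refl | yes refl = contradiction refl (adj-irrefl T u~w)
  ... | yes refl | no  w≢v  rewrite only-x u~w = subst₂ (Adj G) (sym (new d)) (sym (old d w≢v)) (adj-sym G (x~y d))
  ... | no  u≢v  | yes refl rewrite only-x (adj-sym T u~w) = subst₂ (Adj G) (sym (old d u≢v)) (sym (new d)) (x~y d)
  ... | no  u≢v  | no  w≢v  = subst₂ (Adj G) (sym (old d u≢v)) (sym (old d w≢v)) (IsEmbedding.preserves emb u~w)
  disjoint : ∀ {d e} → d ≢ e → ∀ {u w} → u ∈ ⁅ v ⁆ → w ∈ ⁅ v ⁆ → petal d u ≢ petal e w
  disjoint {d} {e} d≢e u∈ w∈ eq with refl ← x∈⁅y⁆⇒x≡y v u∈ | refl ← x∈⁅y⁆⇒x≡y v w∈ =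
    d≢e (Fin.inject≤-injective D≤ D≤ d e (lookup-injective zs! _ _ (trans (sym (new d)) (trans eq (new e)))))

-- Each leaf can be moved alone, so the singletons of `s` leaves serve as components. They are
-- pairwise nonadjacent because `T` is not `K₂`.
leaf-blow-up : (T : Graph t) → IsTree T → ¬ (T ≅ whole K₂) → (G : Graph n) → Core G (D + t) →
  s ≤ leaves T → 1 ≤ D → s * m * t < D → BlowUp T G s m
leaf-blow-up {t} {n} {D} {s} T tree T≇K₂ G core s≤ 1≤D bound
  with xs , g , all-xs ← tree⇒Grown T tree
  with f , embedsOn in-core inj pres ← embed-in-core T G core (ℕ.+-monoˡ-≤ t 1≤D) g =
    assemble emb separated (λ c → leaf-petals T G core (λ u → in-core (all-xs u)) emb (is-leaf c)) bound
  where
  emb : IsEmbedding T G f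
  emb = isEmbedding (inj (all-xs _) (all-xs _)) (pres (all-xs _) (all-xs _))
  leaf? : Decidable (λ u → degree T u ≡ 1)
  leaf? u = degree T u ℕ.≟ 1
  leaf : Fin s → Fin t
  leaf c = List.lookup (filter leaf? (allFin t)) (inject≤ c s≤)
  is-leaf : ∀ c → degree T (leaf c) ≡ 1
  is-leaf c = All.lookup (All.all-filter leaf? (allFin t)) (ListMem.∈-lookup (inject≤ c s≤))
  leaf-injective : ∀ {c d} → leaf c ≡ leaf d → c ≡ d
  leaf-injective {c} {d} eq = Fin.inject≤-injective s≤ s≤ c d
    (lookup-injective (Unique.filter⁺ leaf? (Unique.allFin⁺ t)) _ _ eq)
  separated : Separated T (λ c → ⁅ leaf c ⁆)
  separated = record
    { nonempty = λ c → leaf c , x∈⁅x⁆ (leaf c)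
    ; disjoint = λ c≢d u∈ u∈′ → c≢d (leaf-injective (trans (sym (x∈⁅y⁆⇒x≡y _ u∈)) (x∈⁅y⁆⇒x≡y _ u∈′)))
    ; apart    = λ {c} {d} c≢d u∈ w∈ u~w → T≇K₂ (adjacent-leaves⇒K₂ T (IsTree.connected tree) (is-leaf c) (is-leaf d)
                   (subst₂ (Adj T) (x∈⁅y⁆⇒x≡y _ u∈) (x∈⁅y⁆⇒x≡y _ w∈) u~w)) }

-- Free sets in a ranked graph

any-Vec? : {A : Set} → (∀ {P : A → Set} → Decidable P → Dec (∃ P)) →
  ∀ k {P : Vec A k → Set} → Decidable P → Dec (∃ P)
any-Vec? any? zero    P? = map′ ([] ,_) (λ { ([] , p) → p }) (P? [])
any-Vec? any? (suc k) P? = map′ (λ (x , xs , p) → x ∷ xs , p) (λ { (x ∷ xs , p) → x , xs , p })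
  (any? λ x → any-Vec? any? k λ xs → P? (x ∷ xs))

isEmbedding? : (H : Graph a) (G : Graph b) → Decidable (IsEmbedding H G)
isEmbedding? H G f = map′
  (λ (i , p) → isEmbedding (λ {u} {w} → i u w) (λ {u} {w} → p u w))
  (λ (isEmbedding i p) → (λ u w → i) , λ u w → p)
  ((Fin.all? λ u → Fin.all? λ w → (f u Fin.≟ f w) →-dec (u Fin.≟ w))
   ×-dec (Fin.all? λ u → Fin.all? λ w → (w ∈? lookup (nbr H) u) →-dec (f w ∈? lookup (nbr G) (f u))))

module _ (T : Graph t) (G : Graph n) (ρ : Fin n → ℕ) where
  SameType : (Fin t → Fin n) → (Fin t → Fin n) → Set
  SameType φ ψ = ∀ u w → Adj T u w → ρ (φ u) ≤ ρ (φ w) → ρ (ψ u) ≤ ρ (ψ w)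

  -- Requiring all petals to orient the edges of T along ρ as φ does is what makes
  -- disjoint free sets nonadjacent.
  IsFree : ∀ Q → (Fin t → Fin n) → Subset t → (Fin Q → Fin t → Fin n) → Set
  IsFree Q φ C ψ =
    (∀ d → IsEmbedding T G (ψ d) × (∀ v → v ∉ C → ψ d v ≡ φ v) × SameType φ (ψ d)) ×
    (∀ d e → d ≢ e → ∀ v w → v ∈ C → w ∈ C → ψ d v ≢ ψ e w)

  isFreeSet : ∀ φ C → Decidable (IsFree Q φ C)
  isFreeSet φ C ψ =
    (Fin.all? λ d → isEmbedding? T G (ψ d)
      ×-dec (Fin.all? λ v → ¬? (v ∈? C) →-dec (ψ d v Fin.≟ φ v))
      ×-dec (Fin.all? λ u → Fin.all? λ w → (w ∈? lookup (nbr T) u) →-dec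
        ((ρ (φ u) ℕ.≤? ρ (φ w)) →-dec (ρ (ψ d u) ℕ.≤? ρ (ψ d w)))))
    ×-dec (Fin.all? λ d → Fin.all? λ e → ¬? (d Fin.≟ e) →-dec (Fin.all? λ v → Fin.all? λ w →
      (v ∈? C) →-dec ((w ∈? C) →-dec ¬? (ψ d v Fin.≟ ψ e w))))

  -- Petals are vectors, not functions, so that the search for them is finite and freeness is
  -- decidable, as `helly` demands.
  FreeSet : ℕ → (Fin t → Fin n) → Subset t → Set
  FreeSet Q φ C = ∃ λ (ψ : Vec (Vec (Fin n) t) Q) → IsFree Q φ C (lookup ∘ lookup ψ)

  freeSet? : ∀ Q φ → Decidable (FreeSet Q φ)
  freeSet? Q φ C = any-Vec? (any-Vec? Fin.any? t) Q λ ψ → isFreeSet φ C (lookup ∘ lookup ψ)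

  free⇒petals : ∀ {φ C} → FreeSet Q φ C → Petals T G Q φ C
  free⇒petals (ψ , ok , dis) = record
    { petal = lookup ∘ lookup ψ ; embedding = proj₁ ∘ ok ; outside = λ d → proj₁ (proj₂ (ok d)) _
    ; disjoint = λ d≢e → dis _ _ d≢e _ _ }

module _ (T : Graph t) (G : Graph n) (ranked : Ranked G Q ⊤ˢ) where
  open Ranked ranked

  -- Otherwise the fixed vertex φ u would have Q neighbours of rank at least its own.
  free-upward : ∀ {φ C} → FreeSet T G rank Q φ C → ∀ {u w} → Adj T u w → w ∈ C → rank (φ u) ≤ rank (φ w) → u ∈ C
  free-upward {φ} {C} (ψ , ok , dis) {u} {w} u~w w∈ ρ≤ = decidable-stable (u ∈? C) λ u∉ →
    let outside d = proj₁ (proj₂ (ok d)) u u∉ in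
    ℕ.<-irrefl (List.length-tabulate (at w)) (few ∈⊤
      (Unique.tabulate⁺ λ {d} {e} eq → decidable-stable (d Fin.≟ e) λ d≢e → dis d e d≢e w w w∈ w∈ eq)
      (All.tabulate⁺ λ d → ∈⊤ , subst (λ x → Adj G x (at w d)) (outside d) (IsEmbedding.preserves (proj₁ (ok d)) u~w)
        , subst (λ x → rank x ≤ rank (at w d)) (outside d) (proj₂ (proj₂ (ok d)) u w u~w ρ≤)))
    where
    at : Fin t → Fin Q → Fin n
    at v d = lookup (lookup ψ d) v

  -- On an edge joining the two sets, the end whose image has the larger rank would by `free-upward`
  -- pull the other end into its own set, against disjointness.
  free-apart : ∀ {φ C C′} → FreeSet T G rank Q φ C → FreeSet T G rank Q φ C′ → (∀ {v} → v ∈ C → v ∉ C′) →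
               ∀ {u w} → u ∈ C → w ∈ C′ → ¬ Adj T u w
  free-apart {φ} free free′ disjoint {u} {w} u∈ w∈ u~w with ℕ.≤-total (rank (φ u)) (rank (φ w))
  ... | inj₁ ρ≤ = disjoint u∈ (free-upward free′ u~w w∈ ρ≤)
  ... | inj₂ ρ≥ = disjoint (free-upward free (adj-sym T u~w) u∈ ρ≥) w∈

  type : (Fin t → Fin n) → Vec (Vec Bool t) t
  type φ = Vec.tabulate λ u → Vec.tabulate λ w → does (rank (φ u) ℕ.≤? rank (φ w))

  type-does : ∀ φ u w → lookup (lookup (type φ) u) w ≡ does (rank (φ u) ℕ.≤? rank (φ w))
  type-does φ u w = trans (cong (λ row → lookup row w) (Vec.lookup∘tabulate _ u)) (Vec.lookup∘tabulate _ w)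

  type-≤ : ∀ {φ ψ} → type φ ≡ type ψ → ∀ u w → rank (φ u) ≤ rank (φ w) → rank (ψ u) ≤ rank (ψ w)
  type-≤ {φ} {ψ} eq u w ρ≤ = does-true (rank (ψ u) ℕ.≤? rank (ψ w)) (begin
    does (rank (ψ u) ℕ.≤? rank (ψ w)) ≡⟨ type-does ψ u w ⟨
    lookup (lookup (type ψ) u) w      ≡⟨ cong (λ τ → lookup (lookup τ u) w) eq ⟨
    lookup (lookup (type φ) u) w      ≡⟨ type-does φ u w ⟩
    does (rank (φ u) ℕ.≤? rank (φ w)) ≡⟨ dec-true (rank (φ u) ℕ.≤? rank (φ w)) ρ≤ ⟩
    true                              ∎)
    where
    open ≡-Reasoning
    does-true : {A : Set} (d : Dec A) → does d ≡ true → A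
    does-true (yes p) _ = p

  -- The component C of the moving part can be moved alone: petals are made of
  -- ψ i on C and of the first petal elsewhere.
  sunflower-component-free : ∀ {xs vs R} (g : Grown T vs) → (∀ v → v ∈ˡ vs) → (S : Sunflower Q xs R) →
    (∀ {f} → f ∈ˡ xs → IsEmbedding T G (lookup f)) →
    (∀ {f f′} → f ∈ˡ xs → f′ ∈ˡ xs → type (lookup f) ≡ type (lookup f′)) →
    (K : Component T g (Sunflower.moving S)) → ∀ o → FreeSet T G rank Q (lookup (Sunflower.petal S o)) (Component.piece K)
  sunflower-component-free {xs} g all-vs S emb same K o =
    Vec.tabulate (Vec.tabulate ∘ mix) , (λ d → emb-mix d , outside d , same-type d) , λ d e d≢e v w v∈ w∈ eq →
      disjoint d≢e (⊆W v∈) (⊆W w∈) (trans (sym (on-C d v∈)) (trans eq (on-C e w∈)))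
    where
    open Sunflower S
    open Component K renaming (piece to C)
    φ : Fin t → Fin n
    φ = lookup (petal o)
    ψ : Fin Q → Fin t → Fin n
    ψ d = lookup (petal d)
    mix : Fin Q → Fin t → Fin n
    mix d v = if does (v ∈? C) then ψ d v else φ v
    χ : Fin Q → Fin t → Fin n
    χ d = lookup (lookup (Vec.tabulate (Vec.tabulate ∘ mix)) d)
    χ≡mix : ∀ d v → χ d v ≡ mix d v
    χ≡mix d v = trans (cong (λ f → lookup f v) (Vec.lookup∘tabulate (Vec.tabulate ∘ mix) d)) (Vec.lookup∘tabulate (mix d) v)
    on-C : ∀ d {v} → v ∈ C → χ d v ≡ ψ d v
    on-C d {v} v∈ = trans (χ≡mix d v) (cong (if_then ψ d v else φ v) (dec-true (v ∈? C) v∈))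
    outside : ∀ d v → v ∉ C → χ d v ≡ φ v
    outside d v v∉ = trans (χ≡mix d v) (cong (if_then ψ d v else φ v) (dec-false (v ∈? C) v∉))
    module φ = IsEmbedding (emb (petal∈ o))
    module ψ d = IsEmbedding (emb (petal∈ d))
    -- An edge leaving `C` ends in the kernel, because `C` is a whole component of the moving part.
    -- All petals agree there, so on such an edge the mixture coincides with petal `d`.
    beyond : ∀ d {u w} → u ∈ C → w ∉ C → Adj T u w → χ d w ≡ ψ d w
    beyond d {u} {w} u∈ w∉ u~w = trans (outside d w w∉) (kernel o d λ w∈ → w∉ (closed u∈ (all-vs w) w∈ u~w))
    -- At a kernel position `φ` agrees with petal `d`, which is injective; at a moving position
    -- outside `C` the petals `d` and `o` are disjoint, or are the same injective petal.
    separate : ∀ d {u w} → u ∈ C → w ∉ C → ψ d u ≢ φ w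
    separate d {u} {w} u∈ w∉ eq with w ∈? moving | d Fin.≟ o
    ... | no w∉W  | _        = w∉ (subst (_∈ C) (ψ.injective d (trans eq (kernel o d w∉W))) u∈)
    ... | yes _   | yes refl = w∉ (subst (_∈ C) (φ.injective eq) u∈)
    ... | yes w∈W | no d≢o   = disjoint d≢o (⊆W u∈) w∈W eq
    emb-mix : ∀ d → IsEmbedding T G (χ d)
    emb-mix d = isEmbedding inj pres
      where
      inj : ∀ {u w} → χ d u ≡ χ d w → u ≡ w
      inj {u} {w} eq with u ∈? C | w ∈? C
      ... | yes u∈ | yes w∈ = ψ.injective d (trans (sym (on-C d u∈)) (trans eq (on-C d w∈)))
      ... | no u∉  | no w∉  = φ.injective (trans (sym (outside d u u∉)) (trans eq (outside d w w∉)))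
      ... | yes u∈ | no w∉  = contradiction (trans (sym (on-C d u∈)) (trans eq (outside d w w∉))) (separate d u∈ w∉)
      ... | no u∉  | yes w∈ = contradiction (trans (sym (on-C d w∈)) (trans (sym eq) (outside d u u∉))) (separate d w∈ u∉)
      pres : ∀ {u w} → Adj T u w → Adj G (χ d u) (χ d w)
      pres {u} {w} u~w with u ∈? C | w ∈? C
      ... | yes u∈ | yes w∈ = subst₂ (Adj G) (sym (on-C d u∈)) (sym (on-C d w∈)) (ψ.preserves d u~w)
      ... | no u∉  | no w∉  = subst₂ (Adj G) (sym (outside d u u∉)) (sym (outside d w w∉)) (φ.preserves u~w)
      ... | yes u∈ | no w∉  = subst₂ (Adj G) (sym (on-C d u∈)) (sym (beyond d u∈ w∉ u~w)) (ψ.preserves d u~w)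
      ... | no u∉  | yes w∈ = subst₂ (Adj G) (sym (beyond d w∈ u∉ (adj-sym T u~w))) (sym (on-C d w∈)) (ψ.preserves d u~w)
    same-type : ∀ d → SameType T G rank φ (χ d)
    same-type d u w u~w ρ≤ with u ∈? C | w ∈? C
    ... | yes u∈ | yes w∈ = subst₂ (λ x y → rank x ≤ rank y) (sym (on-C d u∈)) (sym (on-C d w∈)) ψ≤
      where ψ≤ = type-≤ (same (petal∈ o) (petal∈ d)) u w ρ≤
    ... | no u∉  | no w∉  = subst₂ (λ x y → rank x ≤ rank y) (sym (outside d u u∉)) (sym (outside d w w∉)) ρ≤
    ... | yes u∈ | no w∉  = subst₂ (λ x y → rank x ≤ rank y) (sym (on-C d u∈)) (sym (beyond d u∈ w∉ u~w)) ψ≤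
      where ψ≤ = type-≤ (same (petal∈ o) (petal∈ d)) u w ρ≤
    ... | no u∉  | yes w∈ = subst₂ (λ x y → rank x ≤ rank y) (sym (beyond d w∈ u∉ (adj-sym T u~w))) (sym (on-C d w∈)) ψ≤
      where ψ≤ = type-≤ (same (petal∈ o) (petal∈ d)) u w ρ≤

-- Blow-ups from many embeddings

traverse-⊎ : {X B : Set} {P : X → Set} {xs : List X} → All (λ x → P x ⊎ B) xs → All P xs ⊎ B
traverse-⊎ []            = inj₁ []
traverse-⊎ (inj₂ y ∷ _)  = inj₂ y
traverse-⊎ (inj₁ p ∷ ps) with traverse-⊎ ps
... | inj₁ ps′ = inj₁ (p ∷ ps′)
... | inj₂ y   = inj₂ y

-- `assemble` asks for `suc (s * m * t)` petals; the extra `t` makes room in `leaf-petals` for the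
-- vertices already used by the embedding.
petalCount : ℕ → ℕ → ℕ → ℕ
petalCount t s m = suc (s * m * t) + t

-- The factors count the rank types of embeddings, the choices of the `k` vertices that meet all
-- free sets, and the embeddings that may remain without forcing a sunflower. The values on those
-- `k` vertices account for the separate factor `n ^ k`.
embeddingBound : ℕ → ℕ → ℕ → ℕ
embeddingBound t k m = (2 ^ t) ^ t * (t ^ k * sunflowerBound t (petalCount t (suc k) m) t)

many⇒blow-up : (T : Graph t) → IsTree T → ¬ (T ≅ whole K₂) → suc k ≤ leaves T → (G : Graph n) →
  (Φ : List (Vec (Fin n) t)) → Unique Φ → (∀ {f} → f ∈ˡ Φ → IsEmbedding T G (lookup f)) →
  embeddingBound t k m * n ^ k < length Φ → BlowUp T G (suc k) m
many⇒blow-up {t} {k} {n} {m} T tree T≇K₂ k<ℓ G Φ Φ! emb large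
  with degenerate G (petalCount t (suc k) m) n ⊤ˢ (ℕ.≤-reflexive (∣⊤∣≡n n))
... | inj₁ core = leaf-blow-up T tree T≇K₂ G core k<ℓ (s≤s z≤n) ℕ.≤-refl
... | inj₂ ranked with tree⇒Grown T tree
...   | vs , g , all-vs = conclude (traverse-⊎ (All.tabulate λ {f} f∈ → hit-or-pack f (emb f∈)))
  where
  open Ranked ranked
  q : ℕ
  q = petalCount t (suc k) m

  Movable : Vec (Fin n) t → Subset t → Set
  Movable f C = (Conn T g C × Any (_∈ C) vs) × FreeSet T G rank q (lookup f) C

  hit-or-pack : ∀ f → IsEmbedding T G (lookup f) → (∃[ U ] Hit T {k} (Movable f) U) ⊎ BlowUp T G (suc k) m
  hit-or-pack f f-emb with helly T g k {Movable f}
      (λ C → (conn? T g C ×-dec Any.any? (_∈? C) vs) ×-dec freeSet? T G rank q (lookup f) C) proj₁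
  ... | inj₁ hit = inj₁ hit
  ... | inj₂ (packing M M∈ dis) = inj₂ (assemble f-emb separated (λ i → free⇒petals T G rank (proj₂ (M∈ i)))
          (ℕ.m≤m+n _ t))
    where
    separated : Separated T M
    separated = record
      { nonempty = λ i → let v , _ , v∈ = find (proj₂ (proj₁ (M∈ i))) in v , v∈
      ; disjoint = λ i≢j → dis i≢j (all-vs _)
      ; apart    = λ {i} {j} i≢j → free-apart T G ranked (proj₂ (M∈ i)) (proj₂ (M∈ j)) (dis i≢j (all-vs _)) }

  off? : (U : Vec (Fin t) k) → Decidable (λ v → ∀ i → lookup U i ≢ v)
  off? U v = Fin.all? λ i → ¬? (lookup U i Fin.≟ v)

  uniform-few : ∀ (U : Vec (Fin t) k) {Ψ} → Unique Ψ → All (λ f → IsEmbedding T G (lookup f)) Ψ →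
    ∀ {τ κ} → All (λ f → type T G ranked (lookup f) ≡ τ) Ψ → All (λ f → Hit T (Movable f) U) Ψ →
    All (λ f → Vec.map (lookup f) U ≡ κ) Ψ → ¬ sunflowerBound t q t < length Ψ
  uniform-few U {Ψ} Ψ! embs {τ} {κ} types hits on-U large = missed (All.lookup hits (petal∈ zero) piece
      ((conn , meets) , sunflower-component-free T G ranked g all-vs S (All.lookup embs)
        (λ f∈ f∈′ → trans (All.lookup types f∈) (sym (All.lookup types f∈′))) K zero))
    where
    agree : ∀ {f f′ v} → f ∈ˡ Ψ → f′ ∈ˡ Ψ → v ∉ ⟦ off? U ⟧ → lookup f v ≡ lookup f′ v
    agree {f} {f′} {v} f∈ f∈′ v∉ with Fin.any? (λ i → lookup U i Fin.≟ v)
    ... | no  none       = contradiction (∈⟦⟧⁺ (off? U) λ i eq → none (i , eq)) v∉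
    ... | yes (i , refl) = begin
      lookup f (lookup U i)            ≡⟨ Vec.lookup-map i (lookup f) U ⟨
      lookup (Vec.map (lookup f) U) i  ≡⟨ cong (λ κ → lookup κ i) (trans (All.lookup on-U f∈) (sym (All.lookup on-U f∈′))) ⟩
      lookup (Vec.map (lookup f′) U) i ≡⟨ Vec.lookup-map i (lookup f′) U ⟩
      lookup f′ (lookup U i)           ∎
      where open ≡-Reasoning
    S : Sunflower q Ψ ⟦ off? U ⟧
    S = sunflower q t ⟦ off? U ⟧ (∣p∣≤n ⟦ off? U ⟧) Ψ Ψ! agree large
    open Sunflower S
    K : Component T g moving
    K = component T g moving (lose (all-vs _) (proj₂ nonempty))
    open Component K
    missed : ¬ (∃[ i ] lookup U i ∈ piece)
    missed (i , u∈) = ∈⟦⟧⁻ (off? U) (moving⊆ (⊆W u∈)) i refl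

  reorder : embeddingBound t k m * n ^ k ≡ (2 ^ t) ^ t * (t ^ k * (n ^ k * sunflowerBound t q t))
  reorder = begin
    (x * (y * z)) * w ≡⟨ ℕ.*-assoc x (y * z) w ⟩
    x * ((y * z) * w) ≡⟨ cong (x *_) (ℕ.*-assoc y z w) ⟩
    x * (y * (z * w)) ≡⟨ cong (λ u → x * (y * u)) (ℕ.*-comm z w) ⟩
    x * (y * (w * z)) ∎
    where
    open ≡-Reasoning
    x = (2 ^ t) ^ t
    y = t ^ k
    z = sunflowerBound t q t
    w = n ^ k

  conclude : All (λ f → ∃[ U ] Hit T {k} (Movable f) U) Φ ⊎ BlowUp T G (suc k) m → BlowUp T G (suc k) m
  conclude (inj₂ found) = found
  conclude (inj₁ hits)
    with τ , Φ₁ , sub₁ , large₁ , types ← pigeonhole-Vec (pigeonhole-Vec pigeonhole-Bool t) t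
           {R = λ τ f → type T G ranked (lookup f) ≡ τ} Φ _ (All.tabulate λ _ → _ , refl)
           (subst (_< length Φ) reorder large)
    with U , Φ₂ , sub₂ , large₂ , hit ← pigeonhole-Vec (pigeonhole-Fin t) k Φ₁ _ (All-resp-⊆ sub₁ hits) large₁
    with κ , Φ₃ , sub₃ , large₃ , on-U ← pigeonhole-Vec (pigeonhole-Fin n) k
           {R = λ κ f → Vec.map (lookup f) U ≡ κ} Φ₂ _ (All.tabulate λ _ → _ , refl) large₂
    with sub ← ⊆-trans sub₃ (⊆-trans sub₂ sub₁) =
      contradiction large₃ (uniform-few U (AllPairs-resp-⊆ sub Φ!) (All-resp-⊆ sub (All.tabulate emb))
        (All-resp-⊆ (⊆-trans sub₃ sub₂) types) (All-resp-⊆ sub₃ hit) on-U)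

-- Copies as images of embeddings

open Equivalence

copy⇒embedding : {H : Graph a} {G : Graph b} {S : Part b} →
  (copy : IsCopy H G S) → IsEmbedding H G (lookup (proj₁ (proj₂ copy)))
copy⇒embedding (sub , f , iso) = isEmbedding (IsIso.injective iso)
  λ u~w → _IsSubgraphOf_.included sub _ _ (to (IsIso.adjacency iso _ _) u~w)

module _ (H : Graph a) {b : ℕ} (f : Fin a → Fin b) where
  private
    vertex? : Decidable (λ x → ∃[ i ] f i ≡ x)
    vertex? x = Fin.any? λ i → f i Fin.≟ x
    edge? : ∀ x → Decidable (λ y → ∃[ i ] ∃[ j ] (f i ≡ x × f j ≡ y) × Adj H i j)
    edge? x y = Fin.any? λ i → Fin.any? λ j → ((f i Fin.≟ x) ×-dec (f j Fin.≟ y)) ×-dec (j ∈? lookup (nbr H) i)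

  imagePart : Part b
  imagePart = part ⟦ vertex? ⟧ (Vec.tabulate λ x → ⟦ edge? x ⟧)

  image-vertex⁺ : ∀ i → f i ∈ vertices imagePart
  image-vertex⁺ i = ∈⟦⟧⁺ vertex? (i , refl)

  image-vertex⁻ : ∀ {x} → x ∈ vertices imagePart → ∃[ i ] f i ≡ x
  image-vertex⁻ = ∈⟦⟧⁻ vertex?

  private
    edge⁺ : ∀ {i j} → Adj H i j → f j ∈ lookup (edges imagePart) (f i)
    edge⁺ {i} {j} i~j = subst (f j ∈_) (sym (Vec.lookup∘tabulate _ (f i))) (∈⟦⟧⁺ (edge? (f i)) (i , j , (refl , refl) , i~j))

    edge⁻ : ∀ {x y} → y ∈ lookup (edges imagePart) x → ∃[ i ] ∃[ j ] (f i ≡ x × f j ≡ y) × Adj H i j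
    edge⁻ {x} {y} y∈ = ∈⟦⟧⁻ (edge? x) (subst (y ∈_) (Vec.lookup∘tabulate _ x) y∈)

  embedding⇒copy : {G : Graph b} → IsEmbedding H G f → IsCopy H G imagePart
  embedding⇒copy {G} emb = isSubgraph symmetric incident included , Vec.tabulate f , isIso injective image adjacency
    where
    symmetric : ∀ u w → w ∈ lookup (edges imagePart) u → u ∈ lookup (edges imagePart) w
    symmetric u w w∈ with _ , _ , (refl , refl) , i~j ← edge⁻ w∈ = edge⁺ (adj-sym H i~j)
    incident : ∀ u w → w ∈ lookup (edges imagePart) u → u ∈ vertices imagePart × w ∈ vertices imagePart
    incident u w w∈ with i , j , (refl , refl) , _ ← edge⁻ w∈ = image-vertex⁺ i , image-vertex⁺ j
    included : ∀ u w → w ∈ lookup (edges imagePart) u → Adj G u w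
    included u w w∈ with _ , _ , (refl , refl) , i~j ← edge⁻ w∈ = IsEmbedding.preserves emb i~j
    at : ∀ i → lookup (Vec.tabulate f) i ≡ f i
    at = Vec.lookup∘tabulate f
    injective : Injective _≡_ _≡_ (lookup (Vec.tabulate f))
    injective {i} {j} eq = IsEmbedding.injective emb (trans (sym (at i)) (trans eq (at j)))
    image : ∀ x → x ∈ vertices imagePart ⇔ (∃[ i ] lookup (Vec.tabulate f) i ≡ x)
    image x = mk⇔ (λ x∈ → let i , eq = image-vertex⁻ x∈ in i , trans (at i) eq)
                  (λ { (i , refl) → subst (_∈ vertices imagePart) (sym (at i)) (image-vertex⁺ i) })
    adjacency : ∀ i j → Adj H i j ⇔ lookup (Vec.tabulate f) j ∈ lookup (edges imagePart) (lookup (Vec.tabulate f) i)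
    adjacency i j rewrite at i | at j = mk⇔ edge⁺ back
      where
      back : f j ∈ lookup (edges imagePart) (f i) → Adj H i j
      back f∈ with i′ , j′ , (p , q) , i~j ← edge⁻ f∈ =
        subst₂ (Adj H) (IsEmbedding.injective emb p) (IsEmbedding.injective emb q) i~j

-- No edge of a subgraph leaves its vertex set, so vertices and edges can all be read off from `f`.
-- Hence different copies never share an embedding.
iso-unique : {H : Graph a} {G : Graph b} {S S′ : Part b} {f : Vec (Fin b) a} →
  S IsSubgraphOf G → S′ IsSubgraphOf G → IsIso H S f → IsIso H S′ f → S ≡ S′
iso-unique sub sub′ iso iso′ = cong₂ part (⊆-antisym (vertices⊆ iso iso′) (vertices⊆ iso′ iso))
  (lookup-ext λ u → ⊆-antisym (edges⊆ sub iso iso′ u) (edges⊆ sub′ iso′ iso u))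
  where
  vertices⊆ : ∀ {H : Graph a} {S S′ : Part b} {f} → IsIso H S f → IsIso H S′ f → ∀ {x} → x ∈ vertices S → x ∈ vertices S′
  vertices⊆ iso iso′ x∈ = from (IsIso.image iso′ _) (to (IsIso.image iso _) x∈)
  edges⊆ : ∀ {H : Graph a} {G : Graph b} {S S′ : Part b} {f} → S IsSubgraphOf G → IsIso H S f → IsIso H S′ f →
           ∀ u {w} → w ∈ lookup (edges S) u → w ∈ lookup (edges S′) u
  edges⊆ sub iso iso′ u w∈
    with u∈V , w∈V ← _IsSubgraphOf_.incident sub _ _ w∈
    with i , refl ← to (IsIso.image iso _) u∈V | j , refl ← to (IsIso.image iso _) w∈V =
      to (IsIso.adjacency iso′ i j) (from (IsIso.adjacency iso i j) w∈)

-- Enumeration of subgraphs and graphs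

module _ {A : Set} {xs : List A} where
  vectors-unique : Unique xs → ∀ k → Unique (vectors xs k)
  vectors-unique xs! zero    = [] ∷ []
  vectors-unique xs! (suc k) = Unique.cartesianProductWith⁺ _∷_ Vec.∷-injective xs! (vectors-unique xs! k)

  vectors-complete : (∀ x → x ∈ˡ xs) → ∀ {k} (v : Vec A k) → v ∈ˡ vectors xs k
  vectors-complete all []      = here refl
  vectors-complete all (x ∷ v) = ListMem.∈-cartesianProductWith⁺ _∷_ (all x) (vectors-complete all v)

  length-vectors : ∀ k → length (vectors xs k) ≡ length xs ^ k
  length-vectors zero    = refl
  length-vectors (suc k) = trans (length-product xs (vectors xs k)) (cong (length xs *_) (length-vectors k))
    where
    length-product : ∀ {B C : Set} {f : A → B → C} xs ys → length (List.cartesianProductWith f xs ys) ≡ length xs * length ys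
    length-product []       ys = refl
    length-product {f = f} (x ∷ xs) ys = trans (List.length-++ (List.map (f x) ys))
      (cong₂ _+_ (List.length-map (f x) ys) (length-product xs ys))

bools-complete : ∀ x → x ∈ˡ false ∷ true ∷ []
bools-complete false = here refl
bools-complete true  = there (here refl)

subsets-complete : (p : Subset n) → p ∈ˡ subsets n
subsets-complete = vectors-complete bools-complete

parts-unique : ∀ n → Unique (parts n)
parts-unique n = Unique.cartesianProductWith⁺ part (λ { refl → refl , refl }) subsets! (vectors-unique subsets! n)
  where
  subsets! : Unique (subsets n)
  subsets! = vectors-unique (((λ ()) ∷ []) ∷ [] ∷ []) n

parts-complete : (S : Part n) → S ∈ˡ parts n
parts-complete (part V E) = ListMem.∈-cartesianProductWith⁺ part (subsets-complete V) (vectors-complete subsets-complete E)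

-- Only neighbourhoods are compared, since the enumerated graph carries the proof of simplicity that
-- `simple?` computes, which need not be the given one.
graphs-complete : {N : Neighbourhoods n} → Simple N → ∃[ G ] G ∈ˡ graphs n × nbr G ≡ N
graphs-complete {n} {N} N-simple = let G , G∈ , eq = find found in G , G∈ , eq
  where
  candidate : Neighbourhoods n → Maybe (Graph n)
  candidate N = Maybe.map (graph N) (dec⇒maybe (simple? N))
  valid : MaybeAny.Any (λ G → nbr G ≡ N) (candidate N)
  valid with simple? N
  ... | yes _ = MaybeAny.just refl
  ... | no ¬simple = contradiction N-simple ¬simple
  found : Any (λ G → nbr G ≡ N) (graphs n)
  found = Any.mapMaybe⁺ candidate (vectors (subsets n) n)
    (Any.map⁺ (lose (vectors-complete subsets-complete N) valid))

copies≤ex : (H : Graph a) (𝓕 : Family) {G : Graph n} → G ∈ˡ graphs n → Free 𝓕 G → copies H G ≤ ex n H 𝓕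
copies≤ex H 𝓕 G∈ free = Extrema.v≤max⁺ 0 _ (inj₂ (Any.map⁺ (lose (ListMem.∈-filter⁺ (free? 𝓕) G∈ free) ℕ.≤-refl)))

<ex⇒graph : (H : Graph a) (𝓕 : Family) {c : ℕ} → c < ex n H 𝓕 → ∃[ G ] Free 𝓕 G × c < copies {n = n} H G
<ex⇒graph {n = n} H 𝓕 {c} c<ex with Any.any? (λ G → c ℕ.<? copies H G) (filter (free? 𝓕) (graphs n))
... | yes any = let G , G∈ , c< = find any in G , proj₂ (ListMem.∈-filter⁻ (free? 𝓕) {xs = graphs n} G∈) , c<
... | no none = contradiction (Extrema.max≤v⁺ z≤n (All.map⁺ (All.map ℕ.≮⇒≥ (All.¬Any⇒All¬ _ none)))) (ℕ.<⇒≱ c<ex)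

copies⇒embeddings : (H : Graph a) (G : Graph b) →
  ∃[ Φ ] length Φ ≡ copies H G × Unique Φ × (∀ {f} → f ∈ˡ Φ → IsEmbedding H G (lookup f))
copies⇒embeddings {a} {b} H G
  with collect _ (Unique.filter⁺ (isCopy? H G) (parts-unique b)) (All.all-filter (isCopy? H G) (parts b))
  where
  Witness : List (Part b) → Vec (Fin b) a → Set
  Witness Ss f = ∃[ S ] S ∈ˡ Ss × S IsSubgraphOf G × IsIso H S f
  collect : ∀ Ss → Unique Ss → All (IsCopy H G) Ss → ∃[ Φ ] length Φ ≡ length Ss × Unique Φ × All (Witness Ss) Φ
  collect []       []         []                     = [] , refl , [] , []
  collect (S ∷ Ss) (S∉ ∷ Ss!) ((sub , f , iso) ∷ cs) with collect Ss Ss! cs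
  ... | Φ , len , Φ! , ws = f ∷ Φ , cong suc len , All.¬Any⇒All¬ _ f∉ ∷ Φ! ,
        (S , here refl , sub , iso) ∷ All.map (λ (S , S∈ , rest) → S , there S∈ , rest) ws
    where
    f∉ : f ∉ˡ Φ
    f∉ f∈ with S′ , S′∈ , sub′ , iso′ ← All.lookup ws f∈ = All.lookup S∉ S′∈ (iso-unique sub sub′ iso iso′)
... | Φ , len , Φ! , ws = Φ , len , Φ! , λ f∈ → let _ , _ , sub , iso = All.lookup ws f∈ in copy⇒embedding (sub , _ , iso)

-- The graph with many petals

-- In the blow-up combine p v is the copy of v in petal p.  A kernel vertex lives in
-- petal 0 only; its other copies are isolated.
module _ (T : Graph t) (label : Fin t → Maybe (Fin s)) (M : ℕ) where
  role : Fin (suc M * t) → Fin t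
  role x = proj₂ (remQuot {suc M} t x)

  petalOf : Fin (suc M * t) → Fin (suc M)
  petalOf x = proj₁ (remQuot {suc M} t x)

  role-combine : ∀ p v → role (combine p v) ≡ v
  role-combine p v = cong proj₂ (Fin.remQuot-combine p v)

  petalOf-combine : ∀ p v → petalOf (combine p v) ≡ p
  petalOf-combine p v = cong proj₁ (Fin.remQuot-combine p v)

  vertex-ext : ∀ {x y} → role x ≡ role y → petalOf x ≡ petalOf y → x ≡ y
  vertex-ext {x} {y} r≡ p≡ = trans (sym (Fin.combine-remQuot {suc M} t x))
    (trans (cong₂ combine p≡ r≡) (Fin.combine-remQuot {suc M} t y))

  Live : Fin (suc M * t) → Set
  Live x = label (role x) ≡ nothing → petalOf x ≡ zero

  -- Two labelled vertices are joined only within one petal; an edge at the kernel carries no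
  -- condition, since kernel vertices serve all petals.
  Level : Maybe (Fin s) → Maybe (Fin s) → Fin (suc M) → Fin (suc M) → Set
  Level (just _) (just _) p q = p ≡ q
  Level (just _) nothing  p q = ⊤
  Level nothing  _        p q = ⊤

  level? : ∀ l l′ p q → Dec (Level l l′ p q)
  level? (just _) (just _) p q = p Fin.≟ q
  level? (just _) nothing  p q = yes tt
  level? nothing  _        p q = yes tt

  level-sym : ∀ l l′ {p q} → Level l l′ p q → Level l′ l q p
  level-sym (just _) (just _) eq = sym eq
  level-sym (just _) nothing  _  = tt
  level-sym nothing  (just _) _  = tt
  level-sym nothing  nothing  _  = tt

  Edge : Fin (suc M * t) → Fin (suc M * t) → Set
  Edge x y = Adj T (role x) (role y) × (Live x × Live y) × Level (label (role x)) (label (role y)) (petalOf x) (petalOf y)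

  live? : Decidable Live
  live? x = is-nothing? (label (role x)) →-dec (petalOf x Fin.≟ zero)
    where
    is-nothing? : ∀ l → Dec (l ≡ nothing)
    is-nothing? nothing  = yes refl
    is-nothing? (just _) = no λ ()

  edge? : ∀ x y → Dec (Edge x y)
  edge? x y = (role y ∈? lookup (nbr T) (role x)) ×-dec ((live? x ×-dec live? y)
    ×-dec level? (label (role x)) (label (role y)) (petalOf x) (petalOf y))

  blowUpNbr : Neighbourhoods (suc M * t)
  blowUpNbr = Vec.tabulate λ x → ⟦ edge? x ⟧

  blowUpNbr⁺ : ∀ {x y} → Edge x y → y ∈ lookup blowUpNbr x
  blowUpNbr⁺ {x} {y} e = subst (y ∈_) (sym (Vec.lookup∘tabulate _ x)) (∈⟦⟧⁺ (edge? x) e)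

  blowUpNbr⁻ : ∀ {x y} → y ∈ lookup blowUpNbr x → Edge x y
  blowUpNbr⁻ {x} {y} y∈ = ∈⟦⟧⁻ (edge? x) (subst (y ∈_) (Vec.lookup∘tabulate _ x) y∈)

  blowUpNbr-simple : Simple blowUpNbr
  blowUpNbr-simple = (λ x y y∈ → let adj , (lx , ly) , lev = blowUpNbr⁻ {x} {y} y∈ in
      blowUpNbr⁺ {y} {x} (adj-sym T adj , (ly , lx) , level-sym (label (role x)) _ lev))
    , λ x x∈ → adj-irrefl T (proj₁ (blowUpNbr⁻ {x} {x} x∈)) refl

module _ (T : Graph t) {G : Graph n} (B : BlowUp T G (suc s) m) (M : ℕ)
         {G′ : Graph (suc M * t)} (G′≡ : nbr G′ ≡ blowUpNbr T (BlowUp.label B) M) where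
  open BlowUp B
  private
    Vertex : Set
    Vertex = Fin (suc M * t)
    E : Vertex → Vertex → Set
    E = Edge T label M
    ρ : Vertex → Fin t
    ρ = role T label M
    π : Vertex → Fin (suc M)
    π = petalOf T label M
    Alive : Vertex → Set
    Alive = Live T label M
    edge⁺ : ∀ {x y} → E x y → Adj G′ x y
    edge⁺ {x} {y} e = subst (λ N → y ∈ lookup N x) (sym G′≡) (blowUpNbr⁺ T label M e)
    edge⁻ : ∀ {x y} → Adj G′ x y → E x y
    edge⁻ {x} {y} y∈ = blowUpNbr⁻ T label M (subst (λ N → y ∈ lookup N x) G′≡ y∈)

  -- F meets at most a petals, which are renamed after vertices of F; isolated
  -- vertices go to unused copies of a non-kernel vertex.
  module _ {F : Graph a} {f : Fin a → Vertex} (emb : IsEmbedding F G′ f) (a+a≤m : a + a ≤ m) where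
    private
      -- Petal `p` is named after a vertex of `F` that lies in it; `default` is the fallback for
      -- petals that `F` avoids.
      rep : Fin (suc M) → Fin a → Fin a
      rep p default with Fin.any? (λ i → π (f i) Fin.≟ p)
      ... | yes (i , _) = i
      ... | no  _       = default

      rep-sound : ∀ {p} d → π (f d) ≡ p → π (f (rep p d)) ≡ p
      rep-sound {p} d eq with Fin.any? (λ i → π (f i) Fin.≟ p)
      ... | yes (_ , found) = found
      ... | no  none        = contradiction (d , eq) none

      rep-cong : ∀ {p} d e → π (f d) ≡ p → rep p d ≡ rep p e
      rep-cong {p} d e eq with Fin.any? (λ i → π (f i) Fin.≟ p)
      ... | yes _    = refl
      ... | no  none = contradiction (d , eq) none

      -- The first `a` petals of `G` receive the live vertices and the next `a` the dead ones, hence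
      -- the requirement `a + a ≤ m`.
      live-index dead-index : Fin a → Fin m
      live-index i = inject≤ (rep (π (f i)) i ↑ˡ a) a+a≤m
      dead-index i = inject≤ (a ↑ʳ i) a+a≤m

      inject≤-inj : ∀ {x y} → inject≤ x a+a≤m ≡ inject≤ y a+a≤m → x ≡ y
      inject≤-inj = Fin.inject≤-injective a+a≤m a+a≤m _ _

      live-index-inj : ∀ i j → live-index i ≡ live-index j → π (f i) ≡ π (f j)
      live-index-inj i j eq = trans (sym (rep-sound i refl))
        (trans (cong (π ∘ f) (Fin.↑ˡ-injective a _ _ (inject≤-inj eq))) (rep-sound j refl))

      live-index-cong : ∀ i j → π (f i) ≡ π (f j) → live-index i ≡ live-index j
      live-index-cong i j eq = cong (λ r → inject≤ (r ↑ˡ a) a+a≤m)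
        (trans (cong (λ p → rep p i) eq) (rep-cong i j eq))

      live≢dead : ∀ i j → live-index i ≢ dead-index j
      live≢dead i j eq = ↑ˡ≢↑ʳ (inject≤-inj eq)
        where
        ↑ˡ≢↑ʳ : ∀ {k l} {x : Fin k} {y : Fin l} → x ↑ˡ l ≢ k ↑ʳ y
        ↑ˡ≢↑ʳ {k} {l} {x} {y} eq = contradiction
          (trans (sym (Fin.splitAt-↑ˡ k x l)) (trans (cong (splitAt k) eq) (Fin.splitAt-↑ʳ k l y))) λ ()

      spare : Fin t
      spare = proj₁ (onto zero)

      target : ∀ i → Dec (Alive (f i)) → Fin n
      target i (yes _) = place (live-index i) (ρ (f i))
      target i (no _)  = place (dead-index i) spare

      live-label : ∀ l {x y} → label (ρ x) ≡ l → ρ x ≡ ρ y → Alive x → Alive y → (∀ {c} → l ≡ just c → π x ≡ π y) → x ≡ y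
      live-label nothing  lx r≡ ax ay _ = vertex-ext T label M r≡ (trans (ax lx) (sym (ay (trans (cong label (sym r≡)) lx))))
      live-label (just c) lx r≡ _  _  p≡ = vertex-ext T label M r≡ (p≡ refl)

      target-inj : ∀ i j di dj → target i di ≡ target j dj → i ≡ j
      target-inj i j (yes ai) (yes aj) eq = IsEmbedding.injective emb
        (live-label (label (ρ (f i))) refl (proj₁ (separate eq)) ai aj
          (λ l≡ → live-index-inj i j (proj₂ (separate eq) l≡)))
      target-inj i j (yes _)  (no _)   eq = contradiction
        (proj₂ (separate eq) (trans (cong label (proj₁ (separate eq))) (proj₂ (onto zero)))) (live≢dead i j)
      target-inj i j (no _)   (yes _)  eq = contradiction
        (sym (proj₂ (separate eq) (proj₂ (onto zero)))) (live≢dead j i)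
      target-inj i j (no _)   (no _)   eq =
        Fin.↑ʳ-injective a i j (inject≤-inj (proj₂ (separate eq) (proj₂ (onto zero))))

      -- A kernel vertex has the same place in every petal, so an edge at the kernel can be read
      -- inside the petal of its other end.
      place-adj : ∀ i j l l′ {u w} → label u ≡ l → label w ≡ l′ → Adj T u w →
                  Level T label M l l′ (π (f i)) (π (f j)) → Adj G (place (live-index i) u) (place (live-index j) w)
      place-adj i j nothing _ {w = w} lu lw u~w _ =
        subst (λ x → Adj G x (place (live-index j) w)) (kernel lu) (adjacent u~w)
      place-adj i j (just _) nothing  lu lw u~w _ = subst (Adj G _) (kernel lw) (adjacent u~w)
      place-adj i j (just _) (just _) lu lw u~w p≡ rewrite live-index-cong i j p≡ = adjacent u~w

      target-adj : ∀ i j di dj → E (f i) (f j) → Adj G (target i di) (target j dj)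
      target-adj i j (yes _)  (yes _)  (r~ , _ , lev) = place-adj i j _ _ refl refl r~ lev
      target-adj i j (yes _)  (no ¬aj) (_ , (_ , aj) , _) = contradiction aj ¬aj
      target-adj i j (no ¬ai) _        (_ , (ai , _) , _) = contradiction ai ¬ai

    transfer : ∃ (IsEmbedding F G)
    transfer = (λ i → target i (live? T label M (f i))) , isEmbedding
      (λ {i} {j} → target-inj i j (live? T label M (f i)) (live? T label M (f j)))
      (λ {i} {j} i~j → target-adj i j (live? T label M (f i)) (live? T label M (f j))
        (edge⁻ (IsEmbedding.preserves emb i~j)))

  private
    -- The vector `g` picks a petal for each component independently, while the kernel stays in
    -- petal `zero`. This freedom is the source of the exponent `suc s`.
    height : Vec (Fin (suc M)) (suc s) → Maybe (Fin (suc s)) → Fin (suc M)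
    height g nothing  = zero
    height g (just c) = lookup g c

    ψ : Vec (Fin (suc M)) (suc s) → Fin t → Vertex
    ψ g v = combine (height g (label v)) v

    ψ-embedding : ∀ g → IsEmbedding T G′ (ψ g)
    ψ-embedding g = isEmbedding
      (λ {u} {w} eq → proj₂ (Fin.combine-injective (height g (label u)) u (height g (label w)) w eq))
      λ {u} {w} u~w → edge⁺ (edge u w u~w)
      where
      alive : ∀ v → Alive (ψ g v)
      alive v rewrite petalOf-combine T label M (height g (label v)) v | role-combine T label M (height g (label v)) v =
        λ l≡ → cong (height g) l≡
      level : ∀ l l′ → (∀ {c d} → l ≡ just c → l′ ≡ just d → c ≡ d) → Level T label M l l′ (height g l) (height g l′)
      level (just c) (just d) coh = cong (lookup g) (coh refl refl)
      level (just c) nothing  _   = tt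
      level nothing  _        _   = tt
      edge : ∀ u w → Adj T u w → E (ψ g u) (ψ g w)
      edge u w u~w = adj , (alive u , alive w) , lev
        where
        adj : Adj T (ρ (ψ g u)) (ρ (ψ g w))
        adj = subst₂ (Adj T) (sym (role-combine T label M (height g (label u)) u))
          (sym (role-combine T label M (height g (label w)) w)) u~w
        lev : Level T label M (label (ρ (ψ g u))) (label (ρ (ψ g w))) (π (ψ g u)) (π (ψ g w))
        lev rewrite petalOf-combine T label M (height g (label u)) u | role-combine T label M (height g (label u)) u
                  | petalOf-combine T label M (height g (label w)) w | role-combine T label M (height g (label w)) w =
          level (label u) (label w) (coherent u~w)

    -- A vertex of the large graph remembers its role, so the vertex set of a copy already reveals
    -- in which petal each component lies. Distinct choices thus give distinct copies, whatever the
    -- automorphisms of `T`.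
    ψ-part-injective : ∀ {g h} → imagePart T (ψ g) ≡ imagePart T (ψ h) → g ≡ h
    ψ-part-injective {g} {h} eq = lookup-ext agree
      where
      agree : ∀ c → lookup g c ≡ lookup h c
      agree c with v , lv ← onto c
        with u , ψ≡ ← image-vertex⁻ T (ψ h) (subst (λ S → ψ g v ∈ vertices S) eq (image-vertex⁺ T (ψ g) v))
        with p≡ , refl ← Fin.combine-injective (height h (label u)) u (height g (label v)) v ψ≡ =
          trans (cong (height g) (sym lv)) (trans (sym p≡) (cong (height h) lv))

  power≤copies : suc M ^ suc s ≤ copies T G′
  power≤copies = begin
    suc M ^ suc s                                 ≡⟨ cong (_^ suc s) (List.length-tabulate {n = suc M} id) ⟨
    length (allFin (suc M)) ^ suc s               ≡⟨ length-vectors (suc s) ⟨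
    length gs                                     ≡⟨ List.length-map (imagePart T ∘ ψ) gs ⟨
    length (List.map (imagePart T ∘ ψ) gs)
      ≤⟨ unique-length-≤ (Unique.map⁺ ψ-part-injective (vectors-unique (Unique.allFin⁺ (suc M)) (suc s))) counted ⟩
    copies T G′                                   ∎
    where
    open ℕ.≤-Reasoning
    gs : List (Vec (Fin (suc M)) (suc s))
    gs = vectors (allFin (suc M)) (suc s)
    counted : ∀ {S} → S ∈ˡ List.map (imagePart T ∘ ψ) gs → S ∈ˡ filter (isCopy? T G′) (parts (suc M * t))
    counted S∈ with g , _ , refl ← ListMem.∈-map⁻ (imagePart T ∘ ψ) S∈ =
      ListMem.∈-filter⁺ (isCopy? T G′) (parts-complete _) (embedding⇒copy T (ψ g) (ψ-embedding g))

blow-up⇒power≤ex : (T : Graph t) (𝓕 : Family) {G : Graph n} → Free 𝓕 G → BlowUp T G (suc s) m →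
  All (λ (a , _) → a + a ≤ m) 𝓕 → ∀ M → suc M ^ suc s ≤ ex (suc M * t) T 𝓕
blow-up⇒power≤ex T 𝓕 {G} free B small M
  with G′ , G′∈ , G′≡ ← graphs-complete (blowUpNbr-simple T (BlowUp.label B) M) =
    ℕ.≤-trans (power≤copies T B M G′≡) (copies≤ex T 𝓕 G′∈ free′)
  where
  free′ : Free 𝓕 G′
  free′ = All.zipWith (λ {(_ , F)} (¬copy , a+a≤m) (_ , copy) →
    let f , emb = transfer T B M G′≡ (copy⇒embedding copy) a+a≤m in ¬copy (imagePart F f , embedding⇒copy F f emb))
    (free , small)

-- The jump in the number of copies

familyBound : Family → ℕ
familyBound 𝓕 = Extrema.max 0 (List.map (λ (a , _) → a + a) 𝓕)

-- One value of `n` with too many copies suffices: a blow-up with `familyBound 𝓕` petals, enough for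
-- `transfer`, can be inflated to any number of petals without creating a member of `𝓕`.
dichotomy : (T : Graph t) → IsTree T → ¬ (T ≅ whole K₂) → suc k ≤ leaves T → (𝓕 : Family) →
  embeddingBound t k (familyBound 𝓕) * n ^ k < ex n T 𝓕 → ∀ M → suc M ^ suc k ≤ ex (suc M * t) T 𝓕
dichotomy T tree T≇K₂ k<ℓ 𝓕 large
  with G , free , many ← <ex⇒graph T 𝓕 large
  with Φ , len , Φ! , emb ← copies⇒embeddings T G =
    blow-up⇒power≤ex T 𝓕 free
      (many⇒blow-up T tree T≇K₂ k<ℓ G Φ Φ! emb (subst (_ <_) (sym len) many))
      (All.map⁻ (Extrema.xs≤max 0 _))

-- Rational exponents

fromℕ/1≡mkℚ : ∀ ℓ → fromℕ/1 ℓ ≡ mkℚ (ℤ.+ ℓ) 0 (coprime-sym (coprime-1 ℓ))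
fromℕ/1≡mkℚ ℓ = ℚ.↥p/↧p≡p (mkℚ (ℤ.+ ℓ) 0 (coprime-sym (coprime-1 ℓ)))

numerator-≤ : ∀ r ℓ → 0ℚ ≤ℚ r → r ≤ℚ fromℕ/1 ℓ → ℤ.∣ ↥ r ∣ ≤ ℓ * ↧ₙ r
numerator-≤ r@(mkℚ ℤ.-[1+ p ] d _) ℓ 0≤r r≤ℓ with ℚ.drop-*≤* 0≤r
... | ()
numerator-≤ r@(mkℚ (ℤ.+ p) d _) ℓ 0≤r r≤ℓ = ℤ.drop‿+≤+ (begin
  ℤ.+ p               ≡⟨ ℤ.*-identityʳ (ℤ.+ p) ⟨
  ℤ.+ p ℤ.* ℤ.+ 1     ≤⟨ ℚ.drop-*≤* (subst (r ≤ℚ_) (fromℕ/1≡mkℚ ℓ) r≤ℓ) ⟩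
  ℤ.+ ℓ ℤ.* ℤ.+ suc d ≡⟨ ℤ.pos-* ℓ (suc d) ⟨
  ℤ.+ (ℓ * suc d)     ∎)
  where open ℤ.≤-Reasoning

-- If the denominator divided the numerator, coprimality would force it to be 1.
remainder≢0 : ∀ r → ¬ Integral r → ℤ.∣ ↥ r ∣ % ↧ₙ r ≢ 0
remainder≢0 r@(mkℚ z d coprime) nonint rem≡0 with recompute coprime (divides (ℤ.∣ z ∣ / suc d) multiple , ∣-refl)
  where
  multiple : ℤ.∣ z ∣ ≡ ℤ.∣ z ∣ / suc d * suc d
  multiple = trans (m≡m%n+[m/n]*n ℤ.∣ z ∣ (suc d)) (cong (_+ ℤ.∣ z ∣ / suc d * suc d) rem≡0)
... | refl = nonint (z , sym (ℚ.↥p/↧p≡p r))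

^-distribʳ-* : ∀ j m n → (m * n) ^ j ≡ m ^ j * n ^ j
^-distribʳ-* zero    m n = refl
^-distribʳ-* (suc j) m n = trans (cong (m * n *_) (^-distribʳ-* j m n)) (interchange m n (m ^ j) (n ^ j))
  where open CommutativeSemigroup ℕ.*-commutativeSemigroup using (interchange)

n≤n^suc : ∀ n j → n ≤ n ^ suc j
n≤n^suc zero    j = z≤n
n≤n^suc (suc n) j = subst (_≤ suc n * suc n ^ j) (ℕ.*-identityʳ (suc n)) (ℕ.*-monoʳ-≤ (suc n) (ℕ.m^n>0 (suc n) j))

module _ (f : ℕ → ℕ) (t k p q : ℕ) .{{_ : NonZero t}} .{{_ : NonZero q}} where

  -- The witness `x` is beyond `N` and exceeds `(c * B) ^ q`. If `f x ≤ B * x ^ k`, cancelling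
  -- `x ^ (k * q)` in the lower bound would give `x ^ suc s ≤ (c * B) ^ q`.
  below : ∀ {s c B N} → p ≡ suc s + k * q → (∀ n → N ≤ n → n ^ p ≤ (c * f n) ^ q) → ∃[ n ] B * n ^ k < f n
  below {s} {c} {B} {N} p≡ lower with B * x ^ k ℕ.<? f x
    where
    x : ℕ
    x = suc (N + (c * B) ^ q)
  ... | yes large = _ , large
  ... | no  small = contradiction x≤ (ℕ.<⇒≱ (s≤s (ℕ.m≤n+m ((c * B) ^ q) N)))
    where
    x : ℕ
    x = suc (N + (c * B) ^ q)
    open ℕ.≤-Reasoning
    x≤ : x ≤ (c * B) ^ q
    x≤ = ℕ.≤-trans (n≤n^suc x s) (ℕ.*-cancelʳ-≤ (x ^ suc s) ((c * B) ^ q) (x ^ (k * q)) {{ℕ.m^n≢0 x (k * q)}} (begin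
      x ^ suc s * x ^ (k * q)     ≡⟨ ℕ.^-distribˡ-+-* x (suc s) (k * q) ⟨
      x ^ (suc s + k * q)         ≡⟨ cong (x ^_) p≡ ⟨
      x ^ p                       ≤⟨ lower x (ℕ.m≤n⇒m≤1+n (ℕ.m≤m+n N _)) ⟩
      (c * f x) ^ q               ≤⟨ ℕ.^-monoˡ-≤ q (ℕ.*-monoʳ-≤ c (ℕ.≮⇒≥ small)) ⟩
      (c * (B * x ^ k)) ^ q       ≡⟨ cong (_^ q) (ℕ.*-assoc c B (x ^ k)) ⟨
      (c * B * x ^ k) ^ q         ≡⟨ ^-distribʳ-* q (c * B) (x ^ k) ⟩
      (c * B) ^ q * (x ^ k) ^ q   ≡⟨ cong ((c * B) ^ q *_) (ℕ.^-*-assoc x k q) ⟩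
      (c * B) ^ q * x ^ (k * q)   ∎))

  -- At the argument `x * t`, cancelling `x ^ p` from the two bounds on `f` leaves
  -- `x ^ suc d ≤ C ^ q * t ^ p`, and `x` is chosen larger than that constant.
  above : ∀ {d C N} → suc k * q ≡ p + suc d → (∀ n → N ≤ n → f n ^ q ≤ C ^ q * n ^ p) →
          ¬ (∀ M → suc M ^ suc k ≤ f (suc M * t))
  above {d} {C} {N} p+d≡ upper grows = ℕ.<⇒≱ (s≤s (ℕ.m≤n+m (C ^ q * t ^ p) N)) (ℕ.≤-trans (n≤n^suc x d)
    (ℕ.*-cancelˡ-≤ (x ^ p) {{ℕ.m^n≢0 x p}} (begin
      x ^ p * x ^ suc d         ≡⟨ ℕ.^-distribˡ-+-* x p (suc d) ⟨
      x ^ (p + suc d)           ≡⟨ cong (x ^_) p+d≡ ⟨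
      x ^ (suc k * q)           ≡⟨ ℕ.^-*-assoc x (suc k) q ⟨
      (x ^ suc k) ^ q           ≤⟨ ℕ.^-monoˡ-≤ q (grows (N + C ^ q * t ^ p)) ⟩
      f (x * t) ^ q             ≤⟨ upper (x * t) (ℕ.≤-trans (ℕ.m≤n⇒m≤1+n (ℕ.m≤m+n N _)) (ℕ.m≤m*n x t)) ⟩
      C ^ q * (x * t) ^ p       ≡⟨ cong (C ^ q *_) (^-distribʳ-* p x t) ⟩
      C ^ q * (x ^ p * t ^ p)   ≡⟨ ℕ.*-assoc (C ^ q) (x ^ p) (t ^ p) ⟨
      C ^ q * x ^ p * t ^ p     ≡⟨ cong (_* t ^ p) (ℕ.*-comm (C ^ q) (x ^ p)) ⟩
      x ^ p * C ^ q * t ^ p     ≡⟨ ℕ.*-assoc (x ^ p) (C ^ q) (t ^ p) ⟩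
      x ^ p * (C ^ q * t ^ p)   ∎)))
    where
    x : ℕ
    x = suc (N + C ^ q * t ^ p)
    open ℕ.≤-Reasoning

-- With `κ` the integer part of `r`, the positive fractional part makes `f` exceed `B * n ^ κ` at
-- some `n`. The jump then gives growth of order `n ^ suc κ` along the multiples of `t`, too fast
-- because `r < suc κ`.
fractional-Θ-impossible : (f : ℕ → ℕ) (t ℓ : ℕ) .{{_ : NonZero t}} →
  (∀ {k} → k < ℓ → ∃[ B ] ∀ n → B * n ^ k < f n → ∀ M → suc M ^ suc k ≤ f (suc M * t)) →
  ∀ r → 0ℚ ≤ℚ r → r ≤ℚ fromℕ/1 ℓ → ¬ Integral r → ¬ IsΘ-n^ r f
fractional-Θ-impossible f t ℓ jump r 0≤r r≤ℓ nonint (c , C , N , Θ) with ℤ.∣ ↥ r ∣ % ↧ₙ r in rem≡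
... | zero  = remainder≢0 r nonint rem≡
... | suc s = above f t κ p q {C = C} gap (λ n N≤n → proj₂ (Θ n N≤n)) (proj₂ (jump κ<ℓ) x large)
  where
  p q κ : ℕ
  p = ℤ.∣ ↥ r ∣
  q = ↧ₙ r
  κ = p / q
  p≡ : p ≡ suc s + κ * q
  p≡ = trans (m≡m%n+[m/n]*n p q) (cong (_+ κ * q) rem≡)
  s<q : suc s < q
  s<q = subst (_< q) rem≡ (m%n<n p q)
  κ<ℓ : κ < ℓ
  κ<ℓ = ℕ.*-cancelʳ-< q κ ℓ (ℕ.<-≤-trans (subst (κ * q <_) (sym p≡) (s≤s (ℕ.m≤n+m (κ * q) s)))
          (numerator-≤ r ℓ 0≤r r≤ℓ))
  -- The remainder is below `q`, so the shortfall of `p` is positive, and it is written as a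
  -- successor to fit `above`.
  gap : suc κ * q ≡ p + suc (q ∸ suc (suc s))
  gap = begin
    q + κ * q                                   ≡⟨ cong (_+ κ * q) (ℕ.m+[n∸m]≡n s<q) ⟨
    suc (suc s) + (q ∸ suc (suc s)) + κ * q     ≡⟨ cong (_+ κ * q) (ℕ.+-suc (suc s) (q ∸ suc (suc s))) ⟨
    suc s + suc (q ∸ suc (suc s)) + κ * q       ≡⟨ ℕ.+-assoc (suc s) (suc (q ∸ suc (suc s))) (κ * q) ⟩
    suc s + (suc (q ∸ suc (suc s)) + κ * q)     ≡⟨ cong (suc s +_) (ℕ.+-comm (suc (q ∸ suc (suc s))) (κ * q)) ⟩
    suc s + (κ * q + suc (q ∸ suc (suc s)))     ≡⟨ ℕ.+-assoc (suc s) (κ * q) (suc (q ∸ suc (suc s))) ⟨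
    suc s + κ * q + suc (q ∸ suc (suc s))       ≡⟨ cong (_+ suc (q ∸ suc (suc s))) p≡ ⟨
    p + suc (q ∸ suc (suc s))                   ∎
    where open ≡-Reasoning
  beyond : ∃[ n ] proj₁ (jump κ<ℓ) * n ^ κ < f n
  beyond = below f t κ p q {c = c} {B = proj₁ (jump κ<ℓ)} p≡ (λ n N≤n → proj₁ (Θ n N≤n))
  x : ℕ
  x = proj₁ beyond
  large : proj₁ (jump κ<ℓ) * x ^ κ < f x
  large = proj₂ beyond

theorem2p4 : ∀ {t : ℕ} (T : Graph t) → IsTree T → ¬ (T ≅ whole K₂) →
    ∀ (ℓ : ℕ) → leaves T ≡ ℓ → 2 ≤ ℓ →
    ∀ (r : ℚ) → 0ℚ ≤ℚ r → r ≤ℚ fromℕ/1 ℓ → ¬ Integral r → ¬ Realizable T r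
theorem2p4 {zero} T tree _ _ _ _ _ _ _ _ _ = contradiction (IsTree.nonempty tree) λ ()
theorem2p4 {suc t} T tree T≇K₂ ℓ refl _ r 0≤r r≤ℓ nonint (_ , _ , 𝓕 , Θ) =
  fractional-Θ-impossible (λ n → ex n T 𝓕) (suc t) ℓ
    (λ {k} k<ℓ → embeddingBound (suc t) k (familyBound 𝓕) , λ n → dichotomy {n = n} T tree T≇K₂ k<ℓ 𝓕) r 0≤r r≤ℓ nonint Θ
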